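{- Let $p$ be an odd prime and let $F\colon\mathbb{F}_{p^n}\to\mathbb{F}_{p^n}$ be a plateaued, $2$-to-$1$ function. Then $F$ is planar.
   Context: Let $\zeta_p=e^{2\pi i/p}$ and let $\operatorname{Tr}$ be the absolute trace $\mathbb{F}_{p^n}\to\mathbb{F}_p$. The Walsh transform of $F$ is $W_F(b,a)=\sum_{x\in\mathbb{F}_{p^n}}\zeta_p^{\operatorname{Tr}(bF(x))-\operatorname{Tr}(ax)}$. $F$ is plateaued if for every $b\in\mathbb{F}_{p^n}^*$ there is an integer $s_b$ with $0\le s_b\le n$ such that $|W_F(b,a)|\in\{0,p^{(n+s_b)/2}\}$ for all $a\in\mathbb{F}_{p^n}$. $F$ is $2$-to-$1$ if exactly one element of $\mathbb{F}_{p^n}$ has exactly one preimage and $(p^n-1)/2$ elements have exactly $2$ preimages. $F$ is planar if for every $a\in\mathbb{F}_{p^n}^*$ and every $b\in\mathbb{F}_{p^n}$ the equation $F(x+a)-F(x)=b$ has exactly one solution $x$ (equivalently, $|W_F(b,a)|=p^{n/2}$ for all $b\neq0$ and all $a$). -}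

module Defs where

open import Algebra.Bundles using (CommutativeRing; RawSemiring; Semiring)
import Algebra.Definitions.RawSemiring as RawSemiringDefinitions
open import Data.Fin.Base using (Fin; toℕ)
open import Data.Fin.Properties using (any?) renaming (_≟_ to _≟ᶠ_)
open import Data.List.Base using (List; tabulate; filter; length)
open import Data.Nat.Base as ℕ using (ℕ; _∸_; _/_)
import Data.Nat.Properties as ℕₚ
open import Data.Product using (_×_; _,_; ∃!; ∃-syntax)
open import Data.Sum.Base using (_⊎_)
open import Function.Bundles using (Inverse; Func)
import Function.Properties.Inverse as Inverseₚ
open import Level using (_⊔_; suc)
open import Relation.Binary.Core using (Rel)
open import Relation.Binary.Definitions using (Decidable)
open import Relation.Binary.PropositionalEquality using (_≡_)
import Relation.Binary.PropositionalEquality.Properties as ≡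
open import Relation.Binary.Structures using (IsStrictPartialOrder)
open import Relation.Nullary using (¬_; yes; no)
open import Relation.Nullary.Decidable using (via-injection)

------------------------------------------------------------------------
-- The real numbers: a Cauchy complete Archimedean ordered field.  All
-- such structures are classically isomorphic, so quantifying over them is
-- speaking of ℝ.  The axioms are chosen so that they hold for the
-- constructive reals as well; in particular neither _≈_ nor _<_ is
-- assumed decidable.

record RealNumbers r ℓ₁ ℓ₂ : Set (suc (r ⊔ ℓ₁ ⊔ ℓ₂)) where
  field
    commutativeRing : CommutativeRing r ℓ₁

  open CommutativeRing commutativeRing public
  open RawSemiringDefinitions (Semiring.rawSemiring semiring) using () renaming (_×_ to _×ℕ_)

  infix 4 _<_ _≤_

  field
    _<_                  : Rel Carrier ℓ₂
    isStrictPartialOrder : IsStrictPartialOrder _≈_ _<_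
    <-cotrans            : ∀ {x y} → x < y → ∀ z → x < z ⊎ z < y
    <-tight              : ∀ {x y} → ¬ x < y → ¬ y < x → x ≈ y
    0<1                  : 0# < 1#
    +-monoˡ-<            : ∀ z {x y} → x < y → x + z < y + z
    *-pos                : ∀ {x y} → 0# < x → 0# < y → 0# < x * y
    invertible           : ∀ {x} → x < 0# ⊎ 0# < x → ∃[ y ] x * y ≈ 1#

  _≤_ : Rel Carrier ℓ₂
  x ≤ y = ¬ y < x

  fromℕ : ℕ → Carrier
  fromℕ k = k ×ℕ 1#

  IsCauchy : (ℕ → Carrier) → Set (r ⊔ ℓ₂)
  IsCauchy u = ∀ ε → 0# < ε → ∃[ N ] ∀ i j → N ℕ.≤ i → N ℕ.≤ j → u i - u j < ε

  _ConvergesTo_ : (ℕ → Carrier) → Carrier → Set (r ⊔ ℓ₂)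
  u ConvergesTo l =
    ∀ ε → 0# < ε → ∃[ N ] ∀ i → N ℕ.≤ i → u i - l < ε × l - u i < ε

  field
    archimedean : ∀ x → ∃[ k ] x < fromℕ k
    complete    : ∀ u → IsCauchy u → ∃[ l ] u ConvergesTo l
    -- Square roots follow from completeness; they are included to have a
    -- notation for them.  Nothing is said about √ x for negative x.
    √           : Carrier → Carrier
    √-cong      : ∀ {x y} → x ≈ y → √ x ≈ √ y
    √-nonneg    : ∀ x → 0# ≤ √ x
    √-square    : ∀ {x} → 0# ≤ x → √ x * √ x ≈ x

------------------------------------------------------------------------

module Complex {r ℓ₁ ℓ₂} (ℝ : RealNumbers r ℓ₁ ℓ₂) where
  private module ℝ = RealNumbers ℝ

  infix 5 _+i_

  record ℂ : Set r where
    constructor _+i_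
    field
      re im : ℝ.Carrier

  open ℂ public

  ℂ-rawSemiring : RawSemiring r ℓ₁
  ℂ-rawSemiring = record
    { Carrier = ℂ
    ; _≈_     = λ z w → re z ℝ.≈ re w × im z ℝ.≈ im w
    ; _+_     = λ z w → (re z ℝ.+ re w) +i (im z ℝ.+ im w)
    ; _*_     = λ z w → (re z ℝ.* re w ℝ.- im z ℝ.* im w)
                     +i (re z ℝ.* im w ℝ.+ im z ℝ.* re w)
    ; 0#      = ℝ.0# +i ℝ.0#
    ; 1#      = ℝ.1# +i ℝ.0#
    }

  open RawSemiring ℂ-rawSemiring public
    using (_≈_; _+_; _*_; 0#; 1#)
  open RawSemiringDefinitions ℂ-rawSemiring public
    using (_^_; sum)

  ∣_∣ : ℂ → ℝ.Carrier
  ∣ z ∣ = ℝ.√ (re z ℝ.* re z ℝ.+ im z ℝ.* im z)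

  IsPrimitiveRoot : ℕ → ℂ → Set ℓ₁
  IsPrimitiveRoot m ζ =
    ζ ^ m ≈ 1# × (∀ k → 0 ℕ.< k → k ℕ.< m → ¬ ζ ^ k ≈ 1#)

------------------------------------------------------------------------
-- A field with p ^ n elements (unique up to isomorphism for p prime).

record FiniteField (p n : ℕ) c ℓ : Set (suc (c ⊔ ℓ)) where
  field
    commutativeRing : CommutativeRing c ℓ

  open CommutativeRing commutativeRing public
  open RawSemiringDefinitions (Semiring.rawSemiring semiring) public
    using (_^_; sum) renaming (_×_ to _×ℕ_)

  field
    1≉0         : ¬ 1# ≈ 0#
    invertible  : ∀ {x} → ¬ x ≈ 0# → ∃[ y ] x * y ≈ 1#
    enumeration : Inverse (≡.setoid (Fin (p ℕ.^ n))) setoid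

  element : Fin (p ℕ.^ n) → Carrier
  element = Inverse.to enumeration

  elements : List Carrier
  elements = tabulate element

  _≟_ : Decidable _≈_
  _≟_ = via-injection
    (Inverseₚ.Inverse⇒Injection (Inverseₚ.sym enumeration)) _≟ᶠ_

  Tr : Carrier → Carrier
  Tr x = sum {n} λ i → x ^ (p ℕ.^ toℕ i)

  -- The identification of the prime subfield {k · 1 ∣ 0 ≤ k < p} with
  -- {0, …, p - 1}.  It is only applied to values of Tr and their
  -- differences, which lie in the prime subfield; elsewhere the value 0
  -- is arbitrary.
  residue : Carrier → ℕ
  residue t with any? {n = p} (λ k → (toℕ k ×ℕ 1#) ≟ t)
  ... | yes (k , _) = toℕ k
  ... | no _        = 0

------------------------------------------------------------------------

module _ {p n c ℓ} (𝔽 : FiniteField p n c ℓ) where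
  open FiniteField 𝔽
  open Func using () renaming (to to _⟨$⟩_)

  #preimages : Func setoid setoid → Carrier → ℕ
  #preimages F y = length (filter (λ x → (F ⟨$⟩ x) ≟ y) elements)

  #withPreimages : Func setoid setoid → ℕ → ℕ
  #withPreimages F k = length (filter (λ y → #preimages F y ℕₚ.≟ k) elements)

  TwoToOne : Func setoid setoid → Set
  TwoToOne F =
    #withPreimages F 1 ≡ 1 × #withPreimages F 2 ≡ (p ℕ.^ n ∸ 1) / 2

  Planar : Func setoid setoid → Set (c ⊔ ℓ)
  Planar F = ∀ a → ¬ a ≈ 0# → ∀ b →
    ∃! _≈_ λ x → (F ⟨$⟩ (x + a)) - (F ⟨$⟩ x) ≈ b

  module _ {r ℓ₁ ℓ₂} (ℝ : RealNumbers r ℓ₁ ℓ₂) where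
    private
      module ℝ = RealNumbers ℝ
      module ℂ = Complex ℝ

    Walsh : ℂ.ℂ → Func setoid setoid → Carrier → Carrier → ℂ.ℂ
    Walsh ζ F b a = ℂ.sum λ i → let x = element i in
      ζ ℂ.^ residue (Tr (b * (F ⟨$⟩ x)) - Tr (a * x))

    -- √ (p ^ (n + s)) is p ^ ((n + s) / 2).
    Plateaued : ℂ.ℂ → Func setoid setoid → Set (c ⊔ ℓ ⊔ ℓ₁)
    Plateaued ζ F = ∀ b → ¬ b ≈ 0# → ∃[ s ] s ℕ.≤ n × (∀ a →
        ℂ.∣ Walsh ζ F b a ∣ ℝ.≈ ℝ.0#
      ⊎ ℂ.∣ Walsh ζ F b a ∣ ℝ.≈ ℝ.√ (ℝ.fromℕ (p ℕ.^ (n ℕ.+ s))))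

{-# OPTIONS --safe #-}
module Submission where

-- Since F is 2-to-1, W(b,0) is a root of unity plus twice an element of ℤ[ζ],
-- hence nonzero: 2 is not invertible in ℤ[ζ].  As F is plateaued, it follows
-- that |W(b,0)|² ≥ q = pⁿ for b ≠ 0.  On the other hand, counting the pairs
-- with F x = F y shows that these q - 1 numbers add up to (q - 1) q, so all of
-- them equal q and every |W(b,a)|² with b ≠ 0 is 0 or q.  By Parseval it is q.
-- Fourier inversion then gives exactly one solution of F(x + d) - F(x) = e.

open import Defs
open import Algebra.Bundles using (CommutativeMonoid; CommutativeRing; RawSemiring; Semiring)
import Algebra.Properties.CommutativeMonoid.Sum as MonoidSum
import Algebra.Properties.CommutativeSemigroup
import Algebra.Properties.CommutativeSemiring.Binomial as Binomial
import Algebra.Properties.CommutativeSemiring.Exp as Exp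
import Algebra.Properties.Ring
import Algebra.Properties.Semiring.Mult as Mult
import Algebra.Properties.Semiring.Sum as Sum
import Algebra.Solver.Ring
open import Algebra.Structures using (IsCommutativeRing)
open import Data.Bool.Base using (true; false; if_then_else_)
open import Data.Fin.Base as Fin using (Fin; zero; suc; toℕ; fromℕ<; inject≤)
open import Data.Fin.Permutation using (Permutation′; permutation)
open import Data.Fin.Properties as Fin using
  (any?; inject≤-injective; suc-injective; toℕ-fromℕ; toℕ-fromℕ<; toℕ-inject₁; toℕ-injective; toℕ<n)
open import Data.Integer.Base as ℤ using (ℤ; +_; -[1+_]; _⊖_)
import Data.Integer.Properties as ℤ
import Data.Integer.Solver
open import Data.List.Base using (filter; length; tabulate)
import Data.Maybe.Base as Maybe
open import Data.Nat.Base as ℕ using (ℕ; zero; suc)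
open import Data.Nat.Combinatorics using (_C_; k>n⇒nCk≡0; nC1≡n; nCk+nC[k+1]≡[n+1]C[k+1]; nCn≡1)
open import Data.Nat.Coprimality using (coprime-Bézout; prime⇒coprime)
open import Data.Nat.Divisibility using (_∣_; _∤_; divides; ∣⇒≤; m%n≡0⇒n∣m; m∣m*n)
open import Data.Nat.DivMod using (_/_; _%_; m%n<n; m*n/n≡m; m≡m%n+[m/n]*n)
open import Data.Nat.GCD using (module Bézout)
open import Data.Nat.Primality using (Prime; euclidsLemma; prime[2]; prime⇒nonTrivial; prime⇒nonZero)
import Data.Nat.Properties as ℕ
open import Data.Product using (_×_; _,_; ∃-syntax; proj₁; proj₂)
open import Data.Sum.Base as Sum⊎ using (_⊎_; inj₁; inj₂; [_,_]′)
open import Data.Vec.Base using (Vec; []; _∷_; replicate)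
open import Function.Bundles using (Func; Inverse)
open import Level as Level using (Level; _⊔_)
open import Relation.Binary.PropositionalEquality as ≡ using (_≡_; _≢_)
import Relation.Binary.Reasoning.Setoid as SetoidReasoning
open import Relation.Binary.Structures using (IsStrictPartialOrder)
open import Relation.Nullary using (¬_; Dec; does; no; yes)
open import Relation.Nullary.Decidable using (¬?; dec-false; dec-true; dec⇒maybe; decidable-stable)
open import Relation.Nullary.Negation using (contradiction)
open import Relation.Unary using (Decidable)

-- The reals are constructive: equality of complex numbers is not decidable and `≤` is a negation,
-- so sizes are never compared in ℝ or ℂ. Each squared absolute value in the counting is shown to be
-- the image of a natural number, identities are pulled back along the injection of ℕ into ℂ, and
-- the comparison takes place in ℕ, where termwise `≤` and equal totals force termwise equality.
-- That 2 is not invertible in ℤ[ζ] is obtained by linear algebra: multiplication by `1 + 2z` acts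
-- on the powers of ζ through an integer matrix congruent to the identity modulo 2, and such a
-- matrix is injective over a torsion-free ring. This is applied to |W(b,0)|² rather than to W(b,0),
-- because there the root of unity becomes 1. The number ζ is an arbitrary primitive p-th root of
-- unity; that conjugation inverts it follows from |ζ|² being a nonnegative real whose p-th power is
-- 1. Oddness of p makes q odd, so that `(q - 1) / 2` in `TwoToOne` is an exact quotient.

-- The image of ℤ in a commutative ring.

module IntegerImage {c ℓ} (R : CommutativeRing c ℓ) where
  open CommutativeRing R hiding (zero)
  open Algebra.Properties.Ring ring
  open import Algebra.Properties.CommutativeSemigroup +-commutativeSemigroup using (interchange)
  open Mult semiring using () renaming (_×_ to _×ℕ_; ×-homo-+ to ×ℕ-homo-+)
  open import Algebra.Solver.Ring.AlmostCommutativeRing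
    using (fromCommutativeRing; _-Raw-AlmostCommutative⟶_)
  open SetoidReasoning setoid

  ι : ℤ → Carrier
  ι (+ n)    = n ×ℕ 1#
  ι -[1+ n ] = - (suc n ×ℕ 1#)

  ι-neg : ∀ i → ι (ℤ.- i) ≈ - ι i
  ι-neg (+ zero)  = sym -0#≈0#
  ι-neg (+ suc n) = refl
  ι-neg -[1+ n ]  = sym (-‿involutive _)

  ι-⊖ : ∀ m n → ι (m ⊖ n) ≈ m ×ℕ 1# - n ×ℕ 1#
  ι-⊖ m zero = begin
    m ×ℕ 1#        ≈⟨ +-identityʳ _ ⟨
    m ×ℕ 1# + 0#   ≈⟨ +-congˡ -0#≈0# ⟨
    m ×ℕ 1# - 0#   ∎
  ι-⊖ zero (suc n) = sym (+-identityˡ _)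
  ι-⊖ (suc m) (suc n) = begin
    ι (suc m ⊖ suc n)                        ≡⟨ ≡.cong ι (ℤ.[1+m]⊖[1+n]≡m⊖n m n) ⟩
    ι (m ⊖ n)                                ≈⟨ ι-⊖ m n ⟩
    m ×ℕ 1# - n ×ℕ 1#                          ≈⟨ +-identityˡ _ ⟨
    0# + (m ×ℕ 1# - n ×ℕ 1#)                   ≈⟨ +-congʳ (-‿inverseʳ 1#) ⟨
    (1# - 1#) + (m ×ℕ 1# - n ×ℕ 1#)            ≈⟨ interchange _ _ _ _ ⟩
    suc m ×ℕ 1# + (- 1# - n ×ℕ 1#)             ≈⟨ +-congˡ (-‿+-comm _ _) ⟩
    suc m ×ℕ 1# - suc n ×ℕ 1#                  ∎

  ι-+ : ∀ i j → ι (i ℤ.+ j) ≈ ι i + ι j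
  ι-+ (+ m)    (+ n)    = ×ℕ-homo-+ 1# m n
  ι-+ (+ m)    -[1+ n ] = ι-⊖ m (suc n)
  ι-+ -[1+ m ] (+ n)    = trans (ι-⊖ n (suc m)) (+-comm _ _)
  ι-+ -[1+ m ] -[1+ n ] = begin
    - (suc (suc (m ℕ.+ n)) ×ℕ 1#)       ≡⟨ ≡.cong (λ k → - (suc k ×ℕ 1#)) (≡.sym (ℕ.+-suc m n)) ⟩
    - ((suc m ℕ.+ suc n) ×ℕ 1#)         ≈⟨ -‿cong (×ℕ-homo-+ 1# (suc m) (suc n)) ⟩
    - (suc m ×ℕ 1# + suc n ×ℕ 1#)        ≈⟨ -‿+-comm _ _ ⟨
    - (suc m ×ℕ 1#) - (suc n ×ℕ 1#)      ∎

  private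
    ι-*⁺ : ∀ m j → ι (+ m ℤ.* j) ≈ ι (+ m) * ι j
    ι-*⁺ zero    j = trans (reflexive (≡.cong ι (ℤ.*-zeroˡ j))) (sym (zeroˡ _))
    ι-*⁺ (suc m) j = begin
      ι (+ suc m ℤ.* j)             ≡⟨ ≡.cong ι (ℤ.suc-* (+ m) j) ⟩
      ι (j ℤ.+ + m ℤ.* j)           ≈⟨ ι-+ j (+ m ℤ.* j) ⟩
      ι j + ι (+ m ℤ.* j)           ≈⟨ +-cong (sym (*-identityˡ _)) (ι-*⁺ m j) ⟩
      1# * ι j + m ×ℕ 1# * ι j       ≈⟨ distribʳ _ _ _ ⟨
      ι (+ suc m) * ι j             ∎

  ι-* : ∀ i j → ι (i ℤ.* j) ≈ ι i * ι j
  ι-* (+ m)    j = ι-*⁺ m j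
  ι-* -[1+ m ] j = begin
    ι (-[1+ m ] ℤ.* j)            ≡⟨ ≡.cong ι (ℤ.neg-distribˡ-* (+ suc m) j) ⟨
    ι (ℤ.- (+ suc m ℤ.* j))       ≈⟨ ι-neg (+ suc m ℤ.* j) ⟩
    - ι (+ suc m ℤ.* j)           ≈⟨ -‿cong (ι-*⁺ (suc m) j) ⟩
    - (ι (+ suc m) * ι j)         ≈⟨ -‿distribˡ-* _ _ ⟩
    ι -[1+ m ] * ι j              ∎

  private
    morphism : ℤ.+-*-rawRing -Raw-AlmostCommutative⟶ fromCommutativeRing R
    morphism = record
      { ⟦_⟧    = ι
      ; +-homo = ι-+
      ; *-homo = ι-*
      ; -‿homo = ι-neg
      ; 0-homo = refl
      ; 1-homo = +-identityʳ 1#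
      }

  -- Coefficients are integers because the solver has to recognise equal coefficients, and `_≈_` of
  -- the ring need not be decidable.
  module Solver = Algebra.Solver.Ring ℤ.+-*-rawRing (fromCommutativeRing R) morphism
    (λ i j → Maybe.map (λ i≡j → reflexive (≡.cong ι i≡j)) (dec⇒maybe (i ℤ.≟ j)))


-- Integer matrices congruent to the identity modulo 2.

module ℤ-Solver = Data.Integer.Solver.+-*-Solver

Even Odd : ℤ → Set
Even z = ∃[ k ] z ≡ k ℤ.+ k
Odd z  = ∃[ k ] z ≡ ℤ.1ℤ ℤ.+ (k ℤ.+ k)

-- Together with `odd*even∸even*even`, this is the invariant of an elimination step with odd pivot
-- `a`: diagonal entries stay odd, the others stay even.
odd*odd∸even*even : ∀ {a b c d} → Odd a → Odd b → Even c → Even d → Odd (a ℤ.* b ℤ.- c ℤ.* d)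
odd*odd∸even*even (k , ≡.refl) (l , ≡.refl) (m , ≡.refl) (n , ≡.refl) =
  k ℤ.+ l ℤ.+ (k ℤ.* l ℤ.+ k ℤ.* l) ℤ.- (m ℤ.* n ℤ.+ m ℤ.* n) ,
  solve 4 (λ k l m n →
    (con ℤ.1ℤ :+ (k :+ k)) :* (con ℤ.1ℤ :+ (l :+ l)) :- (m :+ m) :* (n :+ n) :=
    con ℤ.1ℤ :+ ((k :+ l :+ (k :* l :+ k :* l) :- (m :* n :+ m :* n)) :+
                 (k :+ l :+ (k :* l :+ k :* l) :- (m :* n :+ m :* n)))) ≡.refl k l m n
  where open ℤ-Solver

odd*even∸even*even : ∀ {a b c d} → Odd a → Even b → Even c → Even d → Even (a ℤ.* b ℤ.- c ℤ.* d)
odd*even∸even*even (k , ≡.refl) (l , ≡.refl) (m , ≡.refl) (n , ≡.refl) =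
  l ℤ.+ (k ℤ.* l ℤ.+ k ℤ.* l) ℤ.- (m ℤ.* n ℤ.+ m ℤ.* n) ,
  solve 4 (λ k l m n →
    (con ℤ.1ℤ :+ (k :+ k)) :* (l :+ l) :- (m :+ m) :* (n :+ n) :=
    (l :+ (k :* l :+ k :* l) :- (m :* n :+ m :* n)) :+
    (l :+ (k :* l :+ k :* l) :- (m :* n :+ m :* n))) ≡.refl k l m n
  where open ℤ-Solver

TorsionFree : ∀ {c ℓ} → CommutativeRing c ℓ → Set (c ⊔ ℓ)
TorsionFree R = ∀ k {z} → suc k ×ℕ 1# * z ≈ 0# → z ≈ 0#
  where
  open CommutativeRing R
  open Mult semiring using () renaming (_×_ to _×ℕ_)

module OddMatrices {r ℓ} (R : CommutativeRing r ℓ) (torsionFree : TorsionFree R) where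
  open CommutativeRing R hiding (zero)
  open Mult semiring using () renaming (_×_ to _×ℕ_)
  open IntegerImage R
  open Algebra.Properties.Ring ring
  open Sum semiring
  open SetoidReasoning setoid

  -- An odd integer is not zero, hence it is plus or minus a successor, and torsion-freeness
  -- applies. The absurd cases run through the shapes of `k` in `0 = 1 + (k + k)`.
  odd-torsionFree : ∀ {a z} → Odd a → ι a * z ≈ 0# → z ≈ 0#
  odd-torsionFree {+ zero}  (+ zero , ()) _
  odd-torsionFree {+ zero}  (+ suc _ , ()) _
  odd-torsionFree {+ zero}  (-[1+ zero ] , ()) _
  odd-torsionFree {+ zero}  (-[1+ suc _ ] , ()) _
  odd-torsionFree {+ suc k} _ eq = torsionFree k eq
  odd-torsionFree { -[1+ k ]} {z} _ eq = torsionFree k (begin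
    suc k ×ℕ 1# * z           ≈⟨ -‿involutive _ ⟨
    - - (suc k ×ℕ 1# * z)     ≈⟨ -‿cong (-‿distribˡ-* _ _) ⟩
    - (- (suc k ×ℕ 1#) * z)   ≈⟨ -‿cong eq ⟩
    - 0#                     ≈⟨ -0#≈0# ⟩
    0#                       ∎)

  -- Such a matrix is the identity modulo 2, so Gaussian elimination finds
  -- only odd pivots.
  odd-diagonal-injective : ∀ {n} (A : Fin n → Fin n → ℤ) (v : Fin n → Carrier) →
    (∀ i → Odd (A i i)) → (∀ i j → i ≢ j → Even (A i j)) →
    (∀ i → ∑[ j < n ] (ι (A i j) * v j) ≈ 0#) → ∀ i → v i ≈ 0#
  odd-diagonal-injective {suc n} A v diag off Av≈0 = λ where
      zero    → v₀≈0
      (suc i) → v₊≈0 i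
    where
    -- Elimination without division: row `suc i` times the pivot minus row `zero` times the entry to
    -- be removed, so the entries remain integers.
    B : Fin n → Fin n → ℤ
    B i j = A zero zero ℤ.* A (suc i) (suc j) ℤ.- A (suc i) zero ℤ.* A zero (suc j)

    row : Fin (suc n) → Carrier
    row i = ∑[ j < n ] (ι (A i (suc j)) * v (suc j))

    ι-B : ∀ i j → ι (B i j) * v (suc j) ≈
      ι (A zero zero) * (ι (A (suc i) (suc j)) * v (suc j)) +
      - ι (A (suc i) zero) * (ι (A zero (suc j)) * v (suc j))
    ι-B i j = begin
      ι (a ℤ.* b ℤ.- c ℤ.* d) * x                 ≈⟨ *-congʳ (trans (ι-+ (a ℤ.* b) (ℤ.- (c ℤ.* d))) (+-cong (ι-* a b) (trans (ι-neg (c ℤ.* d)) (-‿cong (ι-* c d))))) ⟩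
      (ι a * ι b - ι c * ι d) * x                 ≈⟨ solve 5 (λ a b c d x → (a :* b :- c :* d) :* x := a :* (b :* x) :+ :- c :* (d :* x)) refl (ι a) (ι b) (ι c) (ι d) x ⟩
      ι a * (ι b * x) + - ι c * (ι d * x)         ∎
      where
      open Solver
      a = A zero zero
      b = A (suc i) (suc j)
      c = A (suc i) zero
      d = A zero (suc j)
      x = v (suc j)

    Bv≈0 : ∀ i → ∑[ j < n ] (ι (B i j) * v (suc j)) ≈ 0#
    Bv≈0 i = begin
      ∑[ j < n ] (ι (B i j) * v (suc j))
        ≈⟨ trans (sum-cong-≋ (ι-B i)) (∑-distrib-+ {n} _ _) ⟩
      ∑[ j < n ] (ι (A zero zero) * (ι (A (suc i) (suc j)) * v (suc j))) +
      ∑[ j < n ] (- ι (A (suc i) zero) * (ι (A zero (suc j)) * v (suc j)))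
        ≈⟨ +-cong (*-distribˡ-sum {n} _ _) (*-distribˡ-sum {n} _ _) ⟨
      a * row (suc i) + - c * row zero
        ≈⟨ solve 5 (λ a r c s x → a :* r :+ :- c :* s := a :* (c :* x :+ r) :- c :* (a :* x :+ s)) refl a (row (suc i)) c (row zero) (v zero) ⟩
      a * (c * v zero + row (suc i)) - c * (a * v zero + row zero)
        ≈⟨ +-cong (*-congˡ (Av≈0 (suc i))) (-‿cong (*-congˡ (Av≈0 zero))) ⟩
      a * 0# - c * 0#
        ≈⟨ solve 2 (λ a c → a :* con ℤ.0ℤ :- c :* con ℤ.0ℤ := con ℤ.0ℤ) refl a c ⟩
      0#
        ∎
      where
      open Solver
      a = ι (A zero zero)
      c = ι (A (suc i) zero)

    v₊≈0 : ∀ i → v (suc i) ≈ 0#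
    v₊≈0 = odd-diagonal-injective B (λ j → v (suc j))
      (λ i → odd*odd∸even*even (diag zero) (diag (suc i)) (off _ _ λ ()) (off _ _ λ ()))
      (λ i j i≢j → odd*even∸even*even (diag zero) (off _ _ (λ eq → i≢j (suc-injective eq))) (off _ _ λ ()) (off _ _ λ ()))
      Bv≈0

    v₀≈0 : v zero ≈ 0#
    v₀≈0 = odd-torsionFree (diag zero) (begin
      ι (A zero zero) * v zero              ≈⟨ +-identityʳ _ ⟨
      ι (A zero zero) * v zero + 0#         ≈⟨ +-congˡ (sum-replicate-zero n) ⟨
      ι (A zero zero) * v zero + ∑[ j < n ] 0# ≈⟨ +-congˡ (sum-cong-≋ {n} (λ j → trans (*-congˡ (v₊≈0 j)) (zeroʳ _))) ⟨
      ∑[ j ≤ n ] (ι (A zero j) * v j)       ≈⟨ Av≈0 zero ⟩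
      0#                                    ∎)

-- Integer combinations of the powers of a root of unity.

module SingleTerm {c ℓ} (M : CommutativeMonoid c ℓ) where
  open CommutativeMonoid M
  open MonoidSum M
  open SetoidReasoning setoid

  sum-zero : ∀ {n} {f : Fin n → Carrier} → (∀ i → f i ≈ ε) → sum f ≈ ε
  sum-zero {n} f≈ε = trans (sum-cong-≋ f≈ε) (sum-replicate-zero n)

  sum-single : ∀ {n} (f : Fin n → Carrier) i → (∀ j → j ≢ i → f j ≈ ε) → sum f ≈ f i
  sum-single f zero    f≈ε =
    trans (∙-congˡ (sum-zero (λ j → f≈ε (suc j) λ ()))) (identityʳ _)
  sum-single f (suc i) f≈ε = trans
    (∙-cong (f≈ε zero λ ()) (sum-single (λ j → f (suc j)) i (λ j j≢i → f≈ε (suc j) (λ eq → j≢i (suc-injective eq)))))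
    (identityˡ _)

δ : ∀ {n} → Fin n → Fin n → ℤ
δ i j = if does (j Fin.≟ i) then ℤ.1ℤ else ℤ.0ℤ

δ-diag : ∀ {n} (i : Fin n) → δ i i ≡ ℤ.1ℤ
δ-diag i = ≡.cong (if_then ℤ.1ℤ else ℤ.0ℤ) (dec-true (i Fin.≟ i) ≡.refl)

δ-off : ∀ {n} {i j : Fin n} → j ≢ i → δ i j ≡ ℤ.0ℤ
δ-off {i = i} {j} j≢i = ≡.cong (if_then ℤ.1ℤ else ℤ.0ℤ) (dec-false (j Fin.≟ i) j≢i)

module CyclotomicIntegers {r ℓ} (R : CommutativeRing r ℓ) (torsionFree : TorsionFree R)
  (1≉0 : ¬ CommutativeRing._≈_ R (CommutativeRing.1# R) (CommutativeRing.0# R))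
  (p : ℕ) .{{_ : ℕ.NonZero p}} (ζ : CommutativeRing.Carrier R)
  (ζ^p≈1 : CommutativeRing._≈_ R (Exp._^_ (CommutativeRing.commutativeSemiring R) ζ p) (CommutativeRing.1# R))
  where
  open CommutativeRing R hiding (zero)
  open IntegerImage R
  open OddMatrices R torsionFree
  open Exp commutativeSemiring
  open Sum semiring
  open SingleTerm +-commutativeMonoid
  open SetoidReasoning setoid

  -- All powers below `p` serve as a spanning set, so that `^-mod` alone reduces products to it.
  -- Coefficients need not be unique.
  combination : (Fin p → ℤ) → Carrier
  combination b = ∑[ k < p ] (ι (b k) * ζ ^ toℕ k)

  ℤ[ζ] : Carrier → Set ℓ
  ℤ[ζ] z = ∃[ b ] z ≈ combination b

  ℤ[ζ]-resp : ∀ {z w} → z ≈ w → ℤ[ζ] z → ℤ[ζ] w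
  ℤ[ζ]-resp z≈w (b , eq) = b , trans (sym z≈w) eq

  ℤ[ζ]-0 : ℤ[ζ] 0#
  ℤ[ζ]-0 = (λ _ → ℤ.0ℤ) , sym (sum-zero {p} (λ _ → zeroˡ _))

  combination-+ : ∀ a b → combination a + combination b ≈ combination (λ k → a k ℤ.+ b k)
  combination-+ a b = begin
    combination a + combination b
      ≈⟨ ∑-distrib-+ {p} _ _ ⟨
    ∑[ k < p ] (ι (a k) * ζ ^ toℕ k + ι (b k) * ζ ^ toℕ k)
      ≈⟨ sum-cong-≋ {p} (λ k → trans (sym (distribʳ _ _ _)) (*-congʳ (sym (ι-+ (a k) (b k))))) ⟩
    combination (λ k → a k ℤ.+ b k) ∎

  ℤ[ζ]-+ : ∀ {z w} → ℤ[ζ] z → ℤ[ζ] w → ℤ[ζ] (z + w)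
  ℤ[ζ]-+ (a , z≈) (b , w≈) = (λ k → a k ℤ.+ b k) , trans (+-cong z≈ w≈) (combination-+ a b)

  ℤ[ζ]-sum : ∀ {n} (f : Fin n → Carrier) → (∀ i → ℤ[ζ] (f i)) → ℤ[ζ] (sum f)
  ℤ[ζ]-sum {zero}  f f∈ = ℤ[ζ]-0
  ℤ[ζ]-sum {suc n} f f∈ = ℤ[ζ]-+ (f∈ zero) (ℤ[ζ]-sum (λ i → f (suc i)) (λ i → f∈ (suc i)))

  ℤ[ζ]-scale : ∀ a {z} → ℤ[ζ] z → ℤ[ζ] (ι a * z)
  ℤ[ζ]-scale a {z} (b , z≈) = (λ k → a ℤ.* b k) , (begin
    ι a * z                                       ≈⟨ *-congˡ z≈ ⟩
    ι a * combination b                           ≈⟨ *-distribˡ-sum {p} _ _ ⟩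
    ∑[ k < p ] (ι a * (ι (b k) * ζ ^ toℕ k))      ≈⟨ sum-cong-≋ {p} (λ k → trans (sym (*-assoc _ _ _)) (*-congʳ (sym (ι-* a (b k))))) ⟩
    combination (λ k → a ℤ.* b k)                 ∎)

  combination-δ : ∀ i → combination (δ i) ≈ ζ ^ toℕ i
  combination-δ i = begin
    combination (δ i)            ≈⟨ sum-single {p} _ i (λ j j≢i → trans (*-congʳ (reflexive (≡.cong ι (δ-off j≢i)))) (zeroˡ _)) ⟩
    ι (δ i i) * ζ ^ toℕ i        ≡⟨ ≡.cong (λ a → ι a * ζ ^ toℕ i) (δ-diag i) ⟩
    ι ℤ.1ℤ * ζ ^ toℕ i           ≈⟨ trans (*-congʳ (+-identityʳ 1#)) (*-identityˡ _) ⟩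
    ζ ^ toℕ i                    ∎

  ^-mod : ∀ m → ζ ^ m ≈ ζ ^ (m % p)
  ^-mod m = begin
    ζ ^ m                              ≡⟨ ≡.cong (ζ ^_) (m≡m%n+[m/n]*n m p) ⟩
    ζ ^ (m % p ℕ.+ m / p ℕ.* p)        ≈⟨ ^-homo-* ζ (m % p) _ ⟩
    ζ ^ (m % p) * ζ ^ (m / p ℕ.* p)    ≈⟨ *-congˡ (lemma (m / p)) ⟩
    ζ ^ (m % p) * 1#                   ≈⟨ *-identityʳ _ ⟩
    ζ ^ (m % p)                        ∎
    where
    lemma : ∀ k → ζ ^ (k ℕ.* p) ≈ 1#
    lemma zero    = refl
    lemma (suc k) = trans (^-homo-* ζ p _) (trans (*-cong ζ^p≈1 (lemma k)) (*-identityˡ _))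

  ℤ[ζ]-^ : ∀ m → ℤ[ζ] (ζ ^ m)
  ℤ[ζ]-^ m = δ i , (begin
    ζ ^ m              ≈⟨ ^-mod m ⟩
    ζ ^ (m % p)        ≡⟨ ≡.cong (ζ ^_) (toℕ-fromℕ< (m%n<n m p)) ⟨
    ζ ^ toℕ i          ≈⟨ combination-δ i ⟨
    combination (δ i)  ∎)
    where i = fromℕ< (m%n<n m p)

  ℤ[ζ]-*^ : ∀ m {z} → ℤ[ζ] z → ℤ[ζ] (z * ζ ^ m)
  ℤ[ζ]-*^ m {z} (b , z≈) = ℤ[ζ]-resp
    (begin
      ∑[ k < p ] (ι (b k) * ζ ^ (toℕ k ℕ.+ m))    ≈⟨ sum-cong-≋ {p} (λ k → trans (*-congˡ (^-homo-* ζ (toℕ k) m)) (sym (*-assoc _ _ _))) ⟩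
      ∑[ k < p ] (ι (b k) * ζ ^ toℕ k * ζ ^ m)    ≈⟨ *-distribʳ-sum {p} _ _ ⟨
      combination b * ζ ^ m                       ≈⟨ *-congʳ z≈ ⟨
      z * ζ ^ m                                   ∎)
    (ℤ[ζ]-sum {p} _ (λ k → ℤ[ζ]-scale (b k) (ℤ[ζ]-^ (toℕ k ℕ.+ m))))

  ℤ[ζ]-* : ∀ {z w} → ℤ[ζ] z → ℤ[ζ] w → ℤ[ζ] (z * w)
  ℤ[ζ]-* {z} {w} z∈ (b , w≈) = ℤ[ζ]-resp
    (begin
      ∑[ k < p ] (ι (b k) * (z * ζ ^ toℕ k))      ≈⟨ sum-cong-≋ {p} (λ k → solve 3 (λ a z x → a :* (z :* x) := z :* (a :* x)) refl _ z (ζ ^ toℕ k)) ⟩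
      ∑[ k < p ] (z * (ι (b k) * ζ ^ toℕ k))      ≈⟨ *-distribˡ-sum {p} _ _ ⟨
      z * combination b                           ≈⟨ *-congˡ w≈ ⟨
      z * w                                       ∎)
    (ℤ[ζ]-sum {p} _ (λ k → ℤ[ζ]-scale (b k) (ℤ[ζ]-*^ (toℕ k) z∈)))
    where open Solver

  -- Multiplying `1 + 2z ≈ 0` by ζ^i and expanding `z ζ^i` in powers of ζ gives row `i` of a linear
  -- system satisfied by the vector (1, ζ, ..., ζ^(p-1)). Its matrix `A` is the identity modulo 2,
  -- so the vector would vanish, although its first entry is 1.
  1+2z≉0 : ∀ {z} → ℤ[ζ] z → ¬ 1# + (z + z) ≈ 0#
  1+2z≉0 {z} z∈ eq = powers≉0 p ≡.refl (odd-diagonal-injective A (λ j → ζ ^ toℕ j) diag off Aζ≈0)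
    where
    b : Fin p → Fin p → ℤ
    b i = proj₁ (ℤ[ζ]-*^ (toℕ i) z∈)

    A : Fin p → Fin p → ℤ
    A i j = δ i j ℤ.+ (b i j ℤ.+ b i j)

    diag : ∀ i → Odd (A i i)
    diag i = b i i , ≡.cong (ℤ._+ (b i i ℤ.+ b i i)) (δ-diag i)

    off : ∀ i j → i ≢ j → Even (A i j)
    off i j i≢j = b i j , ≡.trans (≡.cong (ℤ._+ (b i j ℤ.+ b i j)) (δ-off (λ j≡i → i≢j (≡.sym j≡i)))) (ℤ.+-identityˡ _)

    Aζ≈0 : ∀ i → combination (A i) ≈ 0#
    Aζ≈0 i = begin
      combination (A i)                               ≈⟨ trans (+-congˡ (combination-+ (b i) (b i))) (combination-+ (δ i) _) ⟨
      combination (δ i) + (combination (b i) + combination (b i))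
        ≈⟨ +-cong (combination-δ i) (+-cong zζ zζ) ⟩
      ζ ^ toℕ i + (z * ζ ^ toℕ i + z * ζ ^ toℕ i)     ≈⟨ solve 2 (λ x z → x :+ (z :* x :+ z :* x) := (con ℤ.1ℤ :+ (z :+ z)) :* x) refl (ζ ^ toℕ i) z ⟩
      (ι ℤ.1ℤ + (z + z)) * ζ ^ toℕ i                  ≈⟨ *-congʳ (trans (+-congʳ (+-identityʳ 1#)) eq) ⟩
      0# * ζ ^ toℕ i                                  ≈⟨ zeroˡ _ ⟩
      0#                                              ∎
      where
      open Solver
      zζ = sym (proj₂ (ℤ[ζ]-*^ (toℕ i) z∈))

    -- The variable `n` stands for `p`: matching on it makes the index `zero` available, and the
    -- entry there is 1.
    powers≉0 : ∀ n → n ≡ p → ¬ (∀ (j : Fin n) → ζ ^ toℕ j ≈ 0#)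
    powers≉0 zero    0≡p   _ = ℕ.≢-nonZero⁻¹ p (≡.sym 0≡p)
    powers≉0 (suc n) _     h = 1≉0 (h zero)

-- Characteristic zero, and order in the reals.

module CharacteristicZero {r ℓ} (R : CommutativeRing r ℓ) (torsionFree : TorsionFree R)
  (1≉0 : ¬ CommutativeRing._≈_ R (CommutativeRing.1# R) (CommutativeRing.0# R)) where
  open CommutativeRing R hiding (zero)
  open Mult semiring using () renaming (_×_ to _×ℕ_)
  open Algebra.Properties.Ring ring

  suc×1≉0 : ∀ k → ¬ suc k ×ℕ 1# ≈ 0#
  suc×1≉0 k eq = 1≉0 (torsionFree k (trans (*-identityʳ _) eq))

  -- This carries identities between complex sums back to ℕ, where sizes can be compared.
  ×1-injective : ∀ {m n} → m ×ℕ 1# ≈ n ×ℕ 1# → m ≡ n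
  ×1-injective {zero}  {zero}  eq = ≡.refl
  ×1-injective {zero}  {suc n} eq = contradiction (sym eq) (suc×1≉0 n)
  ×1-injective {suc m} {zero}  eq = contradiction eq (suc×1≉0 m)
  ×1-injective {suc m} {suc n} eq = ≡.cong suc (×1-injective (+-cancelˡ 1# _ _ eq))

module RealFacts {r ℓ₁ ℓ₂} (ℝ : RealNumbers r ℓ₁ ℓ₂) where
  open RealNumbers ℝ hiding (zero)
  open IsStrictPartialOrder isStrictPartialOrder public
    using (<-respˡ-≈; <-respʳ-≈) renaming (irrefl to <-irrefl; trans to <-trans)
  open Algebra.Properties.Ring ring
  open Exp commutativeSemiring
  open IntegerImage commutativeRing
  open SetoidReasoning setoid

  1≉0 : ¬ 1# ≈ 0#
  1≉0 1≈0 = <-irrefl (sym 1≈0) 0<1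

  x<0⇒0<-x : ∀ {x} → x < 0# → 0# < - x
  x<0⇒0<-x {x} x<0 = <-respˡ-≈ (-‿inverseʳ x) (<-respʳ-≈ (+-identityˡ _) (+-monoˡ-< (- x) x<0))

  pos⇒nonneg : ∀ {x} → 0# < x → 0# ≤ x
  pos⇒nonneg 0<x x<0 = <-irrefl refl (<-trans x<0 0<x)

  square-pos : ∀ {x} → x < 0# ⊎ 0# < x → 0# < x * x
  square-pos {x} (inj₁ x<0) = <-respʳ-≈ (solve 1 (λ x → :- x :* :- x := x :* x) refl x)
    (*-pos (x<0⇒0<-x x<0) (x<0⇒0<-x x<0))
    where open Solver
  square-pos (inj₂ 0<x) = *-pos 0<x 0<x

  0-nonneg : 0# ≤ 0#
  0-nonneg = <-irrefl refl

  -- As `≤` is a negation, `x * y < 0#` may be assumed. Then `0# < x` is impossible: tightness would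
  -- give `y ≈ 0#`. So tightness gives `x ≈ 0#`, and the product is 0.
  *-nonneg : ∀ {x y} → 0# ≤ x → 0# ≤ y → 0# ≤ x * y
  *-nonneg {x} {y} 0≤x 0≤y xy<0 = <-irrefl (trans (*-congʳ x≈0) (zeroˡ y)) xy<0
    where
    x≈0 : x ≈ 0#
    x≈0 = <-tight 0≤x λ 0<x →
      let y≈0 = <-tight 0≤y λ 0<y → pos⇒nonneg (*-pos 0<x 0<y) xy<0
      in <-irrefl (trans (*-congˡ y≈0) (zeroʳ x)) xy<0

  square-nonneg : ∀ x → 0# ≤ x * x
  square-nonneg x xx<0 = <-irrefl (trans (*-congʳ x≈0) (zeroˡ x)) xx<0
    where
    x≈0 : x ≈ 0#
    x≈0 = <-tight
      (λ x<0 → pos⇒nonneg (square-pos (inj₁ x<0)) xx<0)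
      (λ 0<x → pos⇒nonneg (square-pos (inj₂ 0<x)) xx<0)

  -- Cotransitivity replaces a case distinction: `y < x + y`, so either `y < 0#`, which is excluded,
  -- or `0# < x + y`.
  pos+nonneg : ∀ {x y} → 0# < x → 0# ≤ y → 0# < x + y
  pos+nonneg {x} {y} 0<x 0≤y with <-cotrans (<-respˡ-≈ (+-identityˡ y) (+-monoˡ-< y 0<x)) 0#
  ... | inj₁ y<0   = contradiction y<0 0≤y
  ... | inj₂ 0<x+y = 0<x+y

  +-nonneg : ∀ {x y} → 0# ≤ x → 0# ≤ y → 0# ≤ x + y
  +-nonneg {x} {y} 0≤x 0≤y x+y<0 with <-cotrans x+y<0 y
  ... | inj₁ x+y<y = 0≤x (<-respʳ-≈ (-‿inverseʳ y) (<-respˡ-≈ cancel (+-monoˡ-< (- y) x+y<y)))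
    where
    cancel : x + y - y ≈ x
    cancel = solve 2 (λ x y → x :+ y :- y := x) refl x y where open Solver
  ... | inj₂ y<0   = 0≤y y<0

  fromℕ-nonneg : ∀ k → 0# ≤ fromℕ k
  fromℕ-nonneg zero    = 0-nonneg
  fromℕ-nonneg (suc k) = +-nonneg (pos⇒nonneg 0<1) (fromℕ-nonneg k)

  pos-cancel : ∀ {x y} → 0# < x → x * y ≈ 0# → y ≈ 0#
  pos-cancel {x} {y} 0<x xy≈0 with invertible (inj₂ 0<x)
  ... | z , xz≈1 = begin
    y            ≈⟨ *-identityˡ y ⟨
    1# * y       ≈⟨ *-congʳ xz≈1 ⟨
    x * z * y    ≈⟨ solve 3 (λ x y z → x :* z :* y := z :* (x :* y)) refl x y z ⟩
    z * (x * y)  ≈⟨ *-congˡ xy≈0 ⟩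
    z * 0#       ≈⟨ zeroʳ z ⟩
    0#           ∎
    where open Solver

  torsionFree : TorsionFree commutativeRing
  torsionFree k = pos-cancel (pos+nonneg 0<1 (fromℕ-nonneg k))

  private
    -- The sum 1 + t + ... + t^(k-1) in Horner form.
    geometric : Carrier → ℕ → Carrier
    geometric t zero    = 0#
    geometric t (suc k) = 1# + t * geometric t k

    geometric-nonneg : ∀ {t} → 0# ≤ t → ∀ k → 0# ≤ geometric t k
    geometric-nonneg 0≤t zero    = 0-nonneg
    geometric-nonneg 0≤t (suc k) = +-nonneg (pos⇒nonneg 0<1) (*-nonneg 0≤t (geometric-nonneg 0≤t k))

    geometric-sum : ∀ t k → geometric t k * (t - 1#) ≈ t ^ k - 1#
    geometric-sum t zero    = trans (zeroˡ _) (sym (-‿inverseʳ 1#))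
    geometric-sum t (suc k) = begin
      (1# + t * geometric t k) * (t - 1#)
        ≈⟨ trans (distribʳ _ _ _) (+-cong (*-identityˡ _) (*-assoc _ _ _)) ⟩
      (t - 1#) + t * (geometric t k * (t - 1#))
        ≈⟨ +-congˡ (*-congˡ (geometric-sum t k)) ⟩
      (t - 1#) + t * (t ^ k - 1#)
        ≈⟨ +-congˡ (trans (distribˡ _ _ _) (+-congˡ (trans (sym (-‿distribʳ-* _ _)) (-‿cong (*-identityʳ t))))) ⟩
      (t - 1#) + (t * t ^ k - t)
        ≈⟨ solve 3 (λ t o x → (t :- o) :+ (x :- t) := x :- o) refl t 1# (t * t ^ k) ⟩
      t * t ^ k - 1#
        ∎
      where open Solver

  -- In t^(k+1) - 1 = (1 + t + ... + t^k)(t - 1) the first factor is 1 plus something nonnegative,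
  -- so it can be cancelled. This avoids comparing `t` with 1, which the order does not decide.
  nonneg-root-of-unity : ∀ {t} → 0# ≤ t → ∀ k → t ^ suc k ≈ 1# → t ≈ 1#
  nonneg-root-of-unity {t} 0≤t k t^k≈1 = x∙y⁻¹≈ε⇒x≈y t 1#
    (pos-cancel (pos+nonneg 0<1 (*-nonneg 0≤t (geometric-nonneg 0≤t k)))
      (trans (geometric-sum t (suc k)) (trans (+-congʳ t^k≈1) (-‿inverseʳ 1#))))

-- What the argument uses of the complex numbers.
record ConjugationDomain r ℓ : Set (Level.suc (r ⊔ ℓ)) where
  infixr 8 _^_

  field
    commutativeRing : CommutativeRing r ℓ

  open CommutativeRing commutativeRing public

  _^_ : Carrier → ℕ → Carrier
  _^_ = Exp._^_ commutativeSemiring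

  field
    torsionFree    : TorsionFree commutativeRing
    1≉0            : ¬ 1# ≈ 0#
    *-cancel-≉0    : ∀ {x y} → ¬ x ≈ 0# → x * y ≈ 0# → y ≈ 0#
    conj           : Carrier → Carrier
    conj-cong      : ∀ {x y} → x ≈ y → conj x ≈ conj y
    conj-0         : conj 0# ≈ 0#
    conj-1         : conj 1# ≈ 1#
    conj-+         : ∀ x y → conj (x + y) ≈ conj x + conj y
    conj-*         : ∀ x y → conj (x * y) ≈ conj x * conj y
    root-of-unity-*-conj : ∀ x n .{{_ : ℕ.NonZero n}} → x ^ n ≈ 1# → x * conj x ≈ 1#

  conj-sum : ∀ {n} (f : Fin n → Carrier) → conj (Sum.sum semiring f) ≈ Sum.sum semiring (λ i → conj (f i))
  conj-sum {ℕ.zero}  f = conj-0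
  conj-sum {ℕ.suc n} f = trans (conj-+ (f Fin.zero) _) (+-congˡ (conj-sum (λ i → f (Fin.suc i))))

-- Complex numbers: conjugation, norm and cancellation.

module ComplexFacts {r ℓ₁ ℓ₂} (ℝ : RealNumbers r ℓ₁ ℓ₂) where
  private
    module ℝ = RealNumbers ℝ
    module ℝ-Exp = Exp ℝ.commutativeSemiring
  open RealFacts ℝ hiding (torsionFree; 1≉0)
  open Complex ℝ using (ℂ; _+i_; re; im; ∣_∣; ℂ-rawSemiring)
  open RawSemiring ℂ-rawSemiring
  open Algebra.Properties.Ring ℝ.ring using (-0#≈0#)

  infix 8 -_
  -_ : ℂ → ℂ
  - z = ℝ.- re z +i ℝ.- im z

  isCommutativeRing : IsCommutativeRing _≈_ _+_ _*_ -_ 0# 1#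
  isCommutativeRing = record
    { isRing = record
      { +-isAbelianGroup = record
        { isGroup = record
          { isMonoid = record
            { isSemigroup = record
              { isMagma = record
                { isEquivalence = record
                  { refl  = ℝ.refl , ℝ.refl
                  ; sym   = λ (p , q) → ℝ.sym p , ℝ.sym q
                  ; trans = λ (p , q) (p′ , q′) → ℝ.trans p p′ , ℝ.trans q q′
                  }
                ; ∙-cong = λ (p , q) (p′ , q′) → ℝ.+-cong p p′ , ℝ.+-cong q q′
                }
              ; assoc = λ _ _ _ → ℝ.+-assoc _ _ _ , ℝ.+-assoc _ _ _
              }
            ; identity = (λ _ → ℝ.+-identityˡ _ , ℝ.+-identityˡ _) , (λ _ → ℝ.+-identityʳ _ , ℝ.+-identityʳ _)
            }
          ; inverse = (λ _ → ℝ.-‿inverseˡ _ , ℝ.-‿inverseˡ _) , (λ _ → ℝ.-‿inverseʳ _ , ℝ.-‿inverseʳ _)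
          ; ⁻¹-cong = λ (p , q) → ℝ.-‿cong p , ℝ.-‿cong q
          }
        ; comm = λ _ _ → ℝ.+-comm _ _ , ℝ.+-comm _ _
        }
      ; *-cong = λ (p , q) (p′ , q′) →
          ℝ.+-cong (ℝ.*-cong p p′) (ℝ.-‿cong (ℝ.*-cong q q′)) ,
          ℝ.+-cong (ℝ.*-cong p q′) (ℝ.*-cong q p′)
      ; *-assoc = λ (a +i b) (c +i d) (e +i f) →
          solve 6 (λ a b c d e f → (a :* c :- b :* d) :* e :- (a :* d :+ b :* c) :* f :=
            a :* (c :* e :- d :* f) :- b :* (c :* f :+ d :* e)) ℝ.refl a b c d e f ,
          solve 6 (λ a b c d e f → (a :* c :- b :* d) :* f :+ (a :* d :+ b :* c) :* e :=
            a :* (c :* f :+ d :* e) :+ b :* (c :* e :- d :* f)) ℝ.refl a b c d e f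
      ; *-identity = *-identityˡ , (λ z → ≈-trans (*-comm z 1#) (*-identityˡ z))
      ; distrib = distribˡ , (λ z x y → ≈-trans (*-comm (x + y) z)
          (≈-trans (distribˡ z x y) (ℝ.+-cong (proj₁ (*-comm z x)) (proj₁ (*-comm z y)) , ℝ.+-cong (proj₂ (*-comm z x)) (proj₂ (*-comm z y)))))
      }
    ; *-comm = *-comm
    }
    where
    open IntegerImage ℝ.commutativeRing
    open Solver

    ≈-trans : ∀ {x y z} → x ≈ y → y ≈ z → x ≈ z
    ≈-trans (p , q) (p′ , q′) = ℝ.trans p p′ , ℝ.trans q q′

    *-comm : ∀ x y → x * y ≈ y * x
    *-comm (a +i b) (c +i d) =
      solve 4 (λ a b c d → a :* c :- b :* d := c :* a :- d :* b) ℝ.refl a b c d ,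
      solve 4 (λ a b c d → a :* d :+ b :* c := c :* b :+ d :* a) ℝ.refl a b c d

    *-identityˡ : ∀ x → 1# * x ≈ x
    *-identityˡ (a +i b) =
      ℝ.trans (ℝ.+-cong (ℝ.*-identityˡ a) (ℝ.trans (ℝ.-‿cong (ℝ.zeroˡ b)) -0#≈0#)) (ℝ.+-identityʳ a) ,
      ℝ.trans (ℝ.+-cong (ℝ.*-identityˡ b) (ℝ.zeroˡ a)) (ℝ.+-identityʳ b)

    distribˡ : ∀ x y z → x * (y + z) ≈ x * y + x * z
    distribˡ (a +i b) (c +i d) (e +i f) =
      solve 6 (λ a b c d e f → a :* (c :+ e) :- b :* (d :+ f) :=
        (a :* c :- b :* d) :+ (a :* e :- b :* f)) ℝ.refl a b c d e f ,
      solve 6 (λ a b c d e f → a :* (d :+ f) :+ b :* (c :+ e) :=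
        (a :* d :+ b :* c) :+ (a :* f :+ b :* e)) ℝ.refl a b c d e f

  commutativeRing : CommutativeRing r ℓ₁
  commutativeRing = record { isCommutativeRing = isCommutativeRing }

  open CommutativeRing commutativeRing public
    using (setoid; refl; sym; trans; reflexive; *-cong; *-congˡ; *-congʳ; +-congˡ; +-cong; *-assoc; *-comm;
           *-identityˡ; *-identityʳ; zeroˡ; semiring; commutativeSemiring)
  open Mult semiring using (×-assoc-*) renaming (_×_ to _×ℕ_)
  open Exp commutativeSemiring
  open SetoidReasoning setoid

  1≉0 : ¬ 1# ≈ 0#
  1≉0 (1≈0 , _) = RealFacts.1≉0 ℝ 1≈0

  torsionFree : TorsionFree commutativeRing
  torsionFree k {z} eq = cancel re (re-× (suc k)) (proj₁ k×z≈0) , cancel im (im-× (suc k)) (proj₂ k×z≈0)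
    where
    open Mult ℝ.semiring using () renaming (_×_ to _×ℝ_; ×-assoc-* to ×ℝ-assoc-*)

    re-× : ∀ n → re (n ×ℕ z) ≡ n ×ℝ re z
    re-× zero    = ≡.refl
    re-× (suc n) = ≡.cong (re z ℝ.+_) (re-× n)

    im-× : ∀ n → im (n ×ℕ z) ≡ n ×ℝ im z
    im-× zero    = ≡.refl
    im-× (suc n) = ≡.cong (im z ℝ.+_) (im-× n)

    k×z≈0 : suc k ×ℕ z ≈ 0#
    k×z≈0 = begin
      suc k ×ℕ z         ≈⟨ Mult.×-congʳ semiring (suc k) (*-identityˡ z) ⟨
      suc k ×ℕ (1# * z)  ≈⟨ ×-assoc-* (suc k) 1# z ⟨
      suc k ×ℕ 1# * z    ≈⟨ eq ⟩
      0#                 ∎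

    cancel : ∀ (f : ℂ → ℝ.Carrier) → f (suc k ×ℕ z) ≡ suc k ×ℝ f z → f (suc k ×ℕ z) ℝ.≈ ℝ.0# → f z ℝ.≈ ℝ.0#
    cancel f eq f≈0 = RealFacts.torsionFree ℝ k
      (ℝ.trans (×ℝ-assoc-* (suc k) ℝ.1# (f z)) (ℝ.trans (Mult.×-congʳ ℝ.semiring (suc k) (ℝ.*-identityˡ (f z)))
        (ℝ.trans (ℝ.reflexive (≡.sym eq)) f≈0)))

  conj : ℂ → ℂ
  conj z = re z +i ℝ.- im z

  conj-cong : ∀ {z w} → z ≈ w → conj z ≈ conj w
  conj-cong (p , q) = p , ℝ.-‿cong q

  conj-0 : conj 0# ≈ 0#
  conj-0 = ℝ.refl , -0#≈0#

  conj-1 : conj 1# ≈ 1#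
  conj-1 = ℝ.refl , -0#≈0#

  conj-+ : ∀ z w → conj (z + w) ≈ conj z + conj w
  conj-+ (a +i b) (c +i d) = ℝ.refl , solve 2 (λ b d → :- (b :+ d) := :- b :+ :- d) ℝ.refl b d
    where
    open IntegerImage ℝ.commutativeRing
    open Solver

  conj-* : ∀ z w → conj (z * w) ≈ conj z * conj w
  conj-* (a +i b) (c +i d) =
    solve 4 (λ a b c d → a :* c :- b :* d := a :* c :- :- b :* :- d) ℝ.refl a b c d ,
    solve 4 (λ a b c d → :- (a :* d :+ b :* c) := a :* :- d :+ :- b :* c) ℝ.refl a b c d
    where
    open IntegerImage ℝ.commutativeRing
    open Solver

  conj-^ : ∀ z n → conj (z ^ n) ≈ conj z ^ n
  conj-^ z zero    = conj-1
  conj-^ z (suc n) = trans (conj-* z (z ^ n)) (*-congˡ (conj-^ z n))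

  norm : ℂ → ℝ.Carrier
  norm z = re z ℝ.* re z ℝ.+ im z ℝ.* im z

  real : ℝ.Carrier → ℂ
  real t = t +i ℝ.0#

  *-conj : ∀ z → z * conj z ≈ real (norm z)
  *-conj (a +i b) =
    solve 2 (λ a b → a :* a :- b :* :- b := a :* a :+ b :* b) ℝ.refl a b ,
    solve 2 (λ a b → a :* :- b :+ b :* a := con ℤ.0ℤ) ℝ.refl a b
    where
    open IntegerImage ℝ.commutativeRing
    open Solver

  norm-nonneg : ∀ z → ℝ.0# ℝ.≤ norm z
  norm-nonneg z = +-nonneg (square-nonneg _) (square-nonneg _)

  real-* : ∀ s t → real (s ℝ.* t) ≈ real s * real t
  real-* s t =
    solve 2 (λ s t → s :* t := s :* t :- con ℤ.0ℤ :* con ℤ.0ℤ) ℝ.refl s t ,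
    solve 2 (λ s t → con ℤ.0ℤ := s :* con ℤ.0ℤ :+ con ℤ.0ℤ :* t) ℝ.refl s t
    where
    open IntegerImage ℝ.commutativeRing
    open Solver

  real-^ : ∀ t n → real (t ℝ-Exp.^ n) ≈ real t ^ n
  real-^ t zero    = refl
  real-^ t (suc n) = trans (real-* t _) (*-congˡ (real-^ t n))

  real-fromℕ : ∀ n → real (ℝ.fromℕ n) ≈ n ×ℕ 1#
  real-fromℕ zero    = refl
  real-fromℕ (suc n) =
    ℝ.+-congˡ (proj₁ (real-fromℕ n)) , ℝ.trans (proj₂ (real-fromℕ n)) (ℝ.sym (ℝ.+-identityˡ _))

  -- Tightness is applied to each coordinate of `w`. If one of them were positive or negative, |w|²
  -- would be positive, and |w|² z = (z w) conj w = 0 would force `z ≈ 0#`.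
  *-cancel-≉0 : ∀ {z w} → ¬ z ≈ 0# → z * w ≈ 0# → w ≈ 0#
  *-cancel-≉0 {z} {w} z≉0 zw≈0 =
    <-tight (λ x → apart (inj₁ (inj₁ x))) (λ x → apart (inj₁ (inj₂ x))) ,
    <-tight (λ x → apart (inj₂ (inj₁ x))) (λ x → apart (inj₂ (inj₂ x)))
    where
    open ℝ using (<-tight; _<_)

    norm*z≈0 : real (norm w) * z ≈ 0#
    norm*z≈0 = begin
      real (norm w) * z   ≈⟨ *-congʳ (*-conj w) ⟨
      w * conj w * z      ≈⟨ trans (*-comm _ z) (sym (*-assoc z w _)) ⟩
      z * w * conj w      ≈⟨ trans (*-congʳ zw≈0) (zeroˡ _) ⟩
      0#                  ∎

    apart : ¬ ((re w < ℝ.0# ⊎ ℝ.0# < re w) ⊎ (im w < ℝ.0# ⊎ ℝ.0# < im w))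
    apart w#0 = z≉0 (pos-cancel (0<norm w#0) (ℝ.trans (ℝ.sym re-real*) (proj₁ norm*z≈0)) ,
                     pos-cancel (0<norm w#0) (ℝ.trans (ℝ.sym im-real*) (proj₂ norm*z≈0)))
      where
      open IntegerImage ℝ.commutativeRing
      open Solver

      0<norm : (re w < ℝ.0# ⊎ ℝ.0# < re w) ⊎ (im w < ℝ.0# ⊎ ℝ.0# < im w) → ℝ.0# < norm w
      0<norm (inj₁ re#0) = pos+nonneg (square-pos re#0) (square-nonneg _)
      0<norm (inj₂ im#0) = <-respʳ-≈ (ℝ.+-comm _ _) (pos+nonneg (square-pos im#0) (square-nonneg _))

      re-real* : re (real (norm w) * z) ℝ.≈ norm w ℝ.* re z
      re-real* = solve 3 (λ t a b → t :* a :- con ℤ.0ℤ :* b := t :* a) ℝ.refl (norm w) (re z) (im z)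

      im-real* : im (real (norm w) * z) ℝ.≈ norm w ℝ.* im z
      im-real* = solve 3 (λ t a b → t :* b :+ con ℤ.0ℤ :* a := t :* b) ℝ.refl (norm w) (re z) (im z)

  ∣∣≈0⇒*-conj≈0 : ∀ z → ∣ z ∣ ℝ.≈ ℝ.0# → z * conj z ≈ 0#
  ∣∣≈0⇒*-conj≈0 z eq = trans (*-conj z) (norm≈0 , ℝ.refl)
    where
    norm≈0 : norm z ℝ.≈ ℝ.0#
    norm≈0 = ℝ.trans (ℝ.sym (ℝ.√-square (norm-nonneg z))) (ℝ.trans (ℝ.*-congʳ eq) (ℝ.zeroˡ _))

  ∣∣≈√⇒*-conj≈ : ∀ z n → ∣ z ∣ ℝ.≈ ℝ.√ (ℝ.fromℕ n) → z * conj z ≈ n ×ℕ 1#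
  ∣∣≈√⇒*-conj≈ z n eq = trans (*-conj z) (trans (norm≈n , ℝ.refl) (real-fromℕ n))
    where
    norm≈n : norm z ℝ.≈ ℝ.fromℕ n
    norm≈n = ℝ.trans (ℝ.sym (ℝ.√-square (norm-nonneg z)))
      (ℝ.trans (ℝ.*-cong eq eq) (ℝ.√-square (fromℕ-nonneg n)))

  -- Taking the n-th power of `z * conj z` shows that |z|² is a nonnegative real root of unity,
  -- hence 1.
  root-of-unity-*-conj : ∀ z n .{{_ : ℕ.NonZero n}} → z ^ n ≈ 1# → z * conj z ≈ 1#
  root-of-unity-*-conj z n@(suc k) z^n≈1 = trans (*-conj z) (norm≈1 , ℝ.refl)
    where
    real-norm^n≈1 : real (norm z ℝ-Exp.^ n) ≈ 1#
    real-norm^n≈1 = begin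
      real (norm z ℝ-Exp.^ n)  ≈⟨ real-^ (norm z) n ⟩
      real (norm z) ^ n        ≈⟨ ^-congˡ n (*-conj z) ⟨
      (z * conj z) ^ n         ≈⟨ ^-distrib-* z (conj z) n ⟩
      z ^ n * conj z ^ n       ≈⟨ *-cong z^n≈1 (trans (sym (conj-^ z n)) (trans (conj-cong z^n≈1) conj-1)) ⟩
      1# * 1#                  ≈⟨ *-identityˡ 1# ⟩
      1#                       ∎

    norm≈1 : norm z ℝ.≈ ℝ.1#
    norm≈1 = nonneg-root-of-unity (norm-nonneg z) k (proj₁ real-norm^n≈1)

  conjugationDomain : ConjugationDomain r ℓ₁
  conjugationDomain = record
    { commutativeRing      = commutativeRing
    ; torsionFree          = torsionFree
    ; 1≉0                  = 1≉0
    ; *-cancel-≉0          = *-cancel-≉0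
    ; conj                 = conj
    ; conj-cong            = conj-cong
    ; conj-0               = conj-0
    ; conj-1               = conj-1
    ; conj-+               = conj-+
    ; conj-*               = conj-*
    ; root-of-unity-*-conj = root-of-unity-*-conj
    }

-- Binomial coefficients modulo a prime.

-- The absorption identity, by induction along Pascal's rule. It exhibits the factor `suc n`, which
-- is the prime in `prime∣pCk`.
[1+k]*[1+n]C[1+k]≡[1+n]*nCk : ∀ n k → suc k ℕ.* (suc n C suc k) ≡ suc n ℕ.* (n C k)
[1+k]*[1+n]C[1+k]≡[1+n]*nCk n       zero    = begin
  1 ℕ.* (suc n C 1)     ≡⟨ ℕ.*-identityˡ _ ⟩
  suc n C 1             ≡⟨ nC1≡n (suc n) ⟩
  suc n                 ≡⟨ ℕ.*-identityʳ (suc n) ⟨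
  suc n ℕ.* 1           ∎
  where open ≡.≡-Reasoning
[1+k]*[1+n]C[1+k]≡[1+n]*nCk zero    (suc k) = ≡.trans
  (≡.cong (suc (suc k) ℕ.*_) (k>n⇒nCk≡0 {1} {suc (suc k)} (ℕ.s≤s (ℕ.s≤s ℕ.z≤n))))
  (≡.trans (ℕ.*-zeroʳ k) (≡.sym (≡.cong (1 ℕ.*_) (k>n⇒nCk≡0 {0} {suc k} (ℕ.s≤s ℕ.z≤n)))))
[1+k]*[1+n]C[1+k]≡[1+n]*nCk (suc n) (suc k) = begin
  suc (suc k) ℕ.* (suc (suc n) C suc (suc k))
    ≡⟨ ≡.cong (suc (suc k) ℕ.*_) (nCk+nC[k+1]≡[n+1]C[k+1] (suc n) (suc k)) ⟨
  suc (suc k) ℕ.* (a ℕ.+ (suc n C suc (suc k)))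
    ≡⟨ ℕ.*-distribˡ-+ (suc (suc k)) a _ ⟩
  a ℕ.+ suc k ℕ.* a ℕ.+ suc (suc k) ℕ.* (suc n C suc (suc k))
    ≡⟨ ≡.cong₂ (λ x y → a ℕ.+ x ℕ.+ y) ([1+k]*[1+n]C[1+k]≡[1+n]*nCk n k) ([1+k]*[1+n]C[1+k]≡[1+n]*nCk n (suc k)) ⟩
  a ℕ.+ suc n ℕ.* (n C k) ℕ.+ suc n ℕ.* (n C suc k)
    ≡⟨ ≡.trans (ℕ.+-assoc a _ _) (≡.cong (a ℕ.+_) (≡.sym (ℕ.*-distribˡ-+ (suc n) (n C k) (n C suc k)))) ⟩
  a ℕ.+ suc n ℕ.* ((n C k) ℕ.+ (n C suc k))
    ≡⟨ ≡.cong (λ x → a ℕ.+ suc n ℕ.* x) (nCk+nC[k+1]≡[n+1]C[k+1] n k) ⟩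
  suc (suc n) ℕ.* a ∎
  where
  open ≡.≡-Reasoning
  a = suc n C suc k

-- By absorption p divides `suc k` times the coefficient, and it cannot divide `suc k`, which is
-- positive and smaller than p.
prime∣pCk : ∀ {p} → Prime p → ∀ k → suc k ℕ.< p → p ∣ p C suc k
prime∣pCk {suc n} p-prime k k<p
  with euclidsLemma (suc k) (suc n C suc k) p-prime
    (≡.subst (suc n ∣_) (≡.sym ([1+k]*[1+n]C[1+k]≡[1+n]*nCk n k)) (m∣m*n (n C k)))
... | inj₁ p∣k = contradiction (∣⇒≤ p∣k) (ℕ.<⇒≱ k<p)
... | inj₂ p∣C = p∣C

-- Counting the roots of monic polynomials.

module MonicPolynomials {c ℓ} (R : CommutativeRing c ℓ) where
  open CommutativeRing R hiding (zero)
  open Exp commutativeSemiring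
  open IntegerImage R
  open SetoidReasoning setoid
  open Algebra.Properties.Ring ring using (x∙y⁻¹≈ε⇒x≈y)

  -- The coefficient list c₀ ∷ … ∷ c_{d-1} stands for c₀ + … + c_{d-1} xᵈ⁻¹ + xᵈ.
  eval : ∀ {d} → Vec Carrier d → Carrier → Carrier
  eval []       x = 1#
  eval (c ∷ cs) x = c + x * eval cs x

  -- Synthetic division by x - r: the coefficients of the quotient are the intermediate values of
  -- Horner's scheme at r.
  quotient : ∀ {d} → Carrier → Vec Carrier (suc d) → Vec Carrier d
  quotient r (c ∷ [])          = []
  quotient r (c ∷ cs@(_ ∷ _))  = eval cs r ∷ quotient r cs

  eval-quotient : ∀ {d} (cs : Vec Carrier (suc d)) r x →
    eval cs x - eval cs r ≈ (x - r) * eval (quotient r cs) x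
  eval-quotient (c ∷ []) r x =
    solve 4 (λ c o r x → (c :+ x :* o) :- (c :+ r :* o) := (x :- r) :* o) refl c 1# r x
    where open Solver
  eval-quotient (c ∷ cs@(_ ∷ _)) r x = begin
    c + x * f x - (c + r * f r)
      ≈⟨ solve 5 (λ c x y fx fy → c :+ x :* fx :- (c :+ y :* fy) := (x :- y) :* fy :+ x :* (fx :- fy)) refl c x r (f x) (f r) ⟩
    (x - r) * f r + x * (f x - f r)
      ≈⟨ +-congˡ (*-congˡ (eval-quotient cs r x)) ⟩
    (x - r) * f r + x * ((x - r) * eval (quotient r cs) x)
      ≈⟨ solve 4 (λ x d a b → d :* a :+ x :* (d :* b) := d :* (a :+ x :* b)) refl x (x - r) (f r) _ ⟩
    (x - r) * (f r + x * eval (quotient r cs) x)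
      ∎
    where
    open Solver
    f = eval cs

  module _ (1≉0 : ¬ 1# ≈ 0#) (cancel : ∀ {x y} → ¬ x ≈ 0# → x * y ≈ 0# → y ≈ 0#) where

    -- Dividing by x minus the first root leaves a monic polynomial that vanishes at the other
    -- roots, since their differences from the first one can be cancelled. Being monic, the last
    -- quotient is the constant 1, which has no root.
    roots≤degree : ∀ {d} (cs : Vec Carrier d) (root : Fin (suc d) → Carrier) →
      (∀ {i j} → root i ≈ root j → i ≡ j) → ¬ (∀ i → eval cs (root i) ≈ 0#)
    roots≤degree []            root inj isRoot = 1≉0 (isRoot zero)
    roots≤degree cs@(_ ∷ _)    root inj isRoot =
      roots≤degree (quotient (root zero) cs) (λ i → root (suc i)) (λ eq → suc-injective (inj eq)) λ i →
        cancel (λ eq → contradiction (inj (x∙y⁻¹≈ε⇒x≈y _ _ eq)) λ ()) (begin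
          (root (suc i) - root zero) * eval (quotient (root zero) cs) (root (suc i))
            ≈⟨ eval-quotient cs (root zero) (root (suc i)) ⟨
          eval cs (root (suc i)) - eval cs (root zero)
            ≈⟨ +-cong (isRoot (suc i)) (-‿cong (isRoot zero)) ⟩
          0# - 0#
            ≈⟨ -‿inverseʳ 0# ⟩
          0# ∎)

  eval-zeros : ∀ d x → eval (replicate d 0#) x ≈ x ^ d
  eval-zeros zero    x = refl
  eval-zeros (suc d) x = trans (+-identityˡ _) (*-congˡ (eval-zeros d x))

  MonicFunction : ℕ → (Carrier → Carrier) → Set _
  MonicFunction d f = ∃[ cs ] ∀ x → eval {d} cs x ≈ f x

  monic-^ : ∀ d → MonicFunction d (_^ d)
  monic-^ d = replicate d 0# , eval-zeros d

  -- The bound `e < d` keeps the sum monic: the implicit leading 1 of the shorter polynomial meets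
  -- an explicit coefficient of the longer one, hence `c + 1#`.
  add : ∀ {d e} → e ℕ.< d → Vec Carrier d → Vec Carrier e → Vec Carrier d
  add (ℕ.s≤s e<d) (c ∷ cs) []       = (c + 1#) ∷ cs
  add (ℕ.s≤s e<d) (c ∷ cs) (b ∷ bs) = (c + b) ∷ add e<d cs bs

  eval-add : ∀ {d e} (e<d : e ℕ.< d) cs bs x → eval (add e<d cs bs) x ≈ eval cs x + eval bs x
  eval-add (ℕ.s≤s e<d) (c ∷ cs) []       x =
    solve 3 (λ c o y → c :+ o :+ y := c :+ y :+ o) refl c 1# _
    where open Solver
  eval-add (ℕ.s≤s e<d) (c ∷ cs) (b ∷ bs) x = begin
    c + b + x * eval (add e<d cs bs) x            ≈⟨ +-congˡ (*-congˡ (eval-add e<d cs bs x)) ⟩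
    c + b + x * (eval cs x + eval bs x)           ≈⟨ solve 5 (λ c b x y z → c :+ b :+ x :* (y :+ z) := (c :+ x :* y) :+ (b :+ x :* z)) refl c b x _ _ ⟩
    (c + x * eval cs x) + (b + x * eval bs x)     ∎
    where open Solver

  monic-+ : ∀ {d e f g} → e ℕ.< d → MonicFunction d f → MonicFunction e g → MonicFunction d (λ x → f x + g x)
  monic-+ e<d (cs , f≈) (bs , g≈) = add e<d cs bs , λ x → trans (eval-add e<d cs bs x) (+-cong (f≈ x) (g≈ x))

-- Finite fields: sums over all elements, Frobenius and trace.

module FieldSums {p n c ℓ} (𝔽 : FiniteField p n c ℓ) {m ℓ′} (M : CommutativeMonoid m ℓ′) where
  open FiniteField 𝔽 using (Carrier; element; enumeration) renaming (_≈_ to _≈ᶠ_; trans to transᶠ)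
  open CommutativeMonoid M renaming (Carrier to A)
  open MonoidSum M
  open SingleTerm M
  open Inverse enumeration

  -- The monoid varies: addition in the field for its characteristic, multiplication for Fermat's
  -- theorem, addition in ℂ for characters and in ℕ for counting.
  ∑ᶠ : (Carrier → A) → A
  ∑ᶠ f = sum (λ i → f (element i))

  ∑ᶠ-cong : ∀ {f g} → (∀ x → f x ≈ g x) → ∑ᶠ f ≈ ∑ᶠ g
  ∑ᶠ-cong f≈g = sum-cong-≋ (λ i → f≈g (element i))

  ∑ᶠ-bijection : ∀ {f : Carrier → A} → (∀ {x y} → x ≈ᶠ y → f x ≈ f y) →
    (σ τ : Carrier → Carrier) → (∀ {x y} → x ≈ᶠ y → σ x ≈ᶠ σ y) → (∀ {x y} → x ≈ᶠ y → τ x ≈ᶠ τ y) →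
    (∀ x → σ (τ x) ≈ᶠ x) → (∀ x → τ (σ x) ≈ᶠ x) → ∑ᶠ f ≈ ∑ᶠ (λ x → f (σ x))
  ∑ᶠ-bijection {f} f-cong σ τ σ-cong τ-cong στ τσ = trans
    (sum-permute (λ i → f (element i)) π)
    (sum-cong-≋ (λ i → f-cong (strictlyInverseˡ (σ (element i)))))
    where
    lift-inverse : ∀ σ τ → (∀ {x y} → x ≈ᶠ y → σ x ≈ᶠ σ y) → (∀ x → σ (τ x) ≈ᶠ x) →
      ∀ i → from (σ (to (from (τ (to i))))) ≡ i
    lift-inverse σ τ σ-cong στ i = ≡.trans
      (from-cong (transᶠ (σ-cong (strictlyInverseˡ _)) (στ (to i)))) (strictlyInverseʳ i)

    π : Permutation′ (p ℕ.^ n)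
    π = permutation (λ i → from (σ (to i))) (λ i → from (τ (to i))) (lift-inverse σ τ σ-cong στ) (lift-inverse τ σ τ-cong τσ)

  element-injective : ∀ {i j} → element i ≈ᶠ element j → i ≡ j
  element-injective eq = ≡.trans (≡.sym (strictlyInverseʳ _)) (≡.trans (from-cong eq) (strictlyInverseʳ _))

  ∑ᶠ-single : ∀ {f : Carrier → A} → (∀ {x y} → x ≈ᶠ y → f x ≈ f y) →
    ∀ x → (∀ y → ¬ y ≈ᶠ x → f y ≈ ε) → ∑ᶠ f ≈ f x
  ∑ᶠ-single {f} f-cong x f≈ε = trans
    (sum-single (λ i → f (element i)) (from x)
      (λ j j≢x → f≈ε (element j) (λ eq → j≢x (≡.trans (≡.sym (strictlyInverseʳ j)) (from-cong eq)))))
    (f-cong (strictlyInverseˡ x))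

module Residue {p n c ℓ} (𝔽 : FiniteField p n c ℓ) where
  open FiniteField 𝔽

  residue-×1 : ∀ {t} → ∃[ k ] toℕ {p} k ×ℕ 1# ≈ t → residue t ×ℕ 1# ≈ t
  residue-×1 {t} t∈ with any? {n = p} (λ k → (toℕ k ×ℕ 1#) ≟ t)
  ... | yes (k , k≈t) = k≈t
  ... | no none       = contradiction t∈ none

module FieldFacts {p n c ℓ} (p-prime : Prime p) (𝔽 : FiniteField p n c ℓ) where
  open FiniteField 𝔽 hiding (zero; sum; _^_; _×ℕ_)
  open Mult semiring using (×-homo-+; ×1-homo-*; ×-congʳ; ×-assoc-*; ×-homo-1) renaming (_×_ to _×ℕ_)
  open Exp commutativeSemiring
  open Sum semiring
  open SingleTerm
  open IntegerImage commutativeRing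
  open MonicPolynomials commutativeRing
  open Algebra.Properties.Ring ring using (+-cancelˡ; x∙y⁻¹≈ε⇒x≈y)
  open SetoidReasoning setoid
  private
    instance
      p≢0 = prime⇒nonZero p-prime
    module Additive = FieldSums 𝔽 +-commutativeMonoid
    module Multiplicative = FieldSums 𝔽 *-commutativeMonoid

  open Additive public using (element-injective)

  p>1 : 1 ℕ.< p
  p>1 = ℕ.nonTrivial⇒n>1 p {{prime⇒nonTrivial p-prime}}

  q : ℕ
  q = p ℕ.^ n

  *-cancel-≉0 : ∀ {x y} → ¬ x ≈ 0# → x * y ≈ 0# → y ≈ 0#
  *-cancel-≉0 {x} {y} x≉0 xy≈0 = let z , xz≈1 = invertible x≉0 in begin
    y            ≈⟨ *-identityˡ y ⟨
    1# * y       ≈⟨ *-congʳ xz≈1 ⟨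
    x * z * y    ≈⟨ solve 3 (λ x y z → x :* z :* y := z :* (x :* y)) refl x y z ⟩
    z * (x * y)  ≈⟨ *-congˡ xy≈0 ⟩
    z * 0#       ≈⟨ zeroʳ z ⟩
    0#           ∎
    where open Solver

  ^-≉0 : ∀ {x} k → ¬ x ≈ 0# → ¬ x ^ k ≈ 0#
  ^-≉0 zero    x≉0 = 1≉0
  ^-≉0 (suc k) x≉0 eq = ^-≉0 k x≉0 (*-cancel-≉0 x≉0 eq)

  ×1-^ : ∀ m k → (m ℕ.^ k) ×ℕ 1# ≈ (m ×ℕ 1#) ^ k
  ×1-^ m zero    = ×-homo-1 1#
  ×1-^ m (suc k) = trans (×1-homo-* m (m ℕ.^ k)) (*-congˡ (×1-^ m k))

  module _ {m ℓ′} (M : CommutativeMonoid m ℓ′) where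
    private
      module M = CommutativeMonoid M
    open FieldSums 𝔽 M using (∑ᶠ; ∑ᶠ-bijection)

    shift : (f : Carrier → M.Carrier) → (∀ {x y} → x ≈ y → f x M.≈ f y) → ∀ a →
      ∑ᶠ f M.≈ ∑ᶠ (λ x → f (x + a))
    shift f f-cong a = ∑ᶠ-bijection f-cong (_+ a) (_- a) +-congʳ +-congʳ
      (λ x → solve 2 (λ x a → x :- a :+ a := x) refl x a)
      (λ x → solve 2 (λ x a → x :+ a :- a := x) refl x a)
      where open Solver

    scaling : (f : Carrier → M.Carrier) → (∀ {x y} → x ≈ y → f x M.≈ f y) → ∀ {a} → ¬ a ≈ 0# →
      ∑ᶠ f M.≈ ∑ᶠ (λ x → f (a * x))
    scaling f f-cong {a} a≉0 = let b , ab≈1 = invertible a≉0 in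
      ∑ᶠ-bijection f-cong (a *_) (b *_) *-congˡ *-congˡ
        (λ x → trans (sym (*-assoc a b x)) (trans (*-congʳ ab≈1) (*-identityˡ x)))
        (λ x → trans (sym (*-assoc b a x)) (trans (*-congʳ (trans (*-comm b a) ab≈1)) (*-identityˡ x)))

  -- Replacing x by x + 1 preserves the sum of all elements, so q · 1 = 0. As q · 1 = (p · 1)^n and
  -- powers of nonzero elements are nonzero, p · 1 = 0.
  p×1≈0 : p ×ℕ 1# ≈ 0#
  p×1≈0 = decidable-stable ((p ×ℕ 1#) ≟ 0#) λ p≉0 → ^-≉0 n p≉0 (trans (sym (×1-^ p n)) q×1≈0)
    where
    open Additive
    q×1≈0 : q ×ℕ 1# ≈ 0#
    q×1≈0 = +-cancelˡ (∑ᶠ (λ x → x)) _ _ (begin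
      ∑ᶠ (λ x → x) + q ×ℕ 1#               ≈⟨ +-congˡ (sum-replicate q) ⟨
      ∑ᶠ (λ x → x) + ∑ᶠ (λ _ → 1#)         ≈⟨ ∑-distrib-+ {q} _ _ ⟨
      ∑ᶠ (λ x → x + 1#)                    ≈⟨ shift +-commutativeMonoid (λ x → x) (λ eq → eq) 1# ⟨
      ∑ᶠ (λ x → x)                         ≈⟨ +-identityʳ _ ⟨
      ∑ᶠ (λ x → x) + 0#                    ∎)

  p∣⇒×≈0 : ∀ {m} z → p ∣ m → m ×ℕ z ≈ 0#
  p∣⇒×≈0 z (divides k ≡.refl) = begin
    (k ℕ.* p) ×ℕ z                 ≈⟨ ×-congʳ (k ℕ.* p) (*-identityˡ z) ⟨
    (k ℕ.* p) ×ℕ (1# * z)          ≈⟨ ×-assoc-* (k ℕ.* p) 1# z ⟨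
    (k ℕ.* p) ×ℕ 1# * z            ≈⟨ *-congʳ (×1-homo-* k p) ⟩
    k ×ℕ 1# * (p ×ℕ 1#) * z        ≈⟨ *-congʳ (trans (*-congˡ p×1≈0) (zeroʳ _)) ⟩
    0# * z                         ≈⟨ zeroˡ z ⟩
    0#                             ∎

  frobenius : ∀ x y → (x + y) ^ p ≈ x ^ p + y ^ p
  frobenius x y = go p ≡.refl
    where
    open Binomial commutativeSemiring using (theorem; binomialTerm)

    -- With `suc m` in place of `p` the binomial sum loses its first term, the power of `y`. Among
    -- the remaining indices only the last has a coefficient that is not a multiple of p.
    go : ∀ m → m ≡ p → (x + y) ^ m ≈ x ^ m + y ^ m
    go zero    0≡p = contradiction (≡.sym 0≡p) (ℕ.≢-nonZero⁻¹ p)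
    go (suc m) m≡p = begin
      (x + y) ^ suc m
        ≈⟨ theorem (suc m) x y ⟩
      binomialTerm x y (suc m) zero + sum (λ k → binomialTerm x y (suc m) (suc k))
        ≈⟨ +-cong (trans (×-homo-1 _) (*-identityˡ _)) (sum-single +-commutativeMonoid _ (Fin.fromℕ m) middle) ⟩
      y ^ suc m + binomialTerm x y (suc m) (Fin.fromℕ (suc m))
        ≈⟨ +-congˡ top ⟩
      y ^ suc m + x ^ suc m
        ≈⟨ +-comm _ _ ⟩
      x ^ suc m + y ^ suc m
        ∎
      where
      middle : ∀ k → k ≢ Fin.fromℕ m → binomialTerm x y (suc m) (suc k) ≈ 0#
      middle k k≢m = p∣⇒×≈0 _ (≡.subst (_∣ suc m C suc (toℕ k)) m≡p (prime∣pCk (≡.subst Prime (≡.sym m≡p) p-prime) (toℕ k)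
        (ℕ.s≤s (ℕ.≤∧≢⇒< (ℕ.s≤s⁻¹ (toℕ<n k)) (λ eq → k≢m (toℕ-injective (≡.trans eq (≡.sym (toℕ-fromℕ m)))))))))

      top : binomialTerm x y (suc m) (Fin.fromℕ (suc m)) ≈ x ^ suc m
      top = begin
        binomialTerm x y (suc m) (Fin.fromℕ (suc m))
          ≡⟨ ≡.cong (λ k → (suc m C k) ×ℕ (x ^ k * y ^ (suc m ℕ.∸ k))) (toℕ-fromℕ (suc m)) ⟩
        (suc m C suc m) ×ℕ (x ^ suc m * y ^ (m ℕ.∸ m))
          ≡⟨ ≡.cong₂ (λ k l → k ×ℕ (x ^ suc m * y ^ l)) (nCn≡1 (suc m)) (ℕ.n∸n≡0 m) ⟩
        1 ×ℕ (x ^ suc m * 1#)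
          ≈⟨ trans (×-homo-1 _) (*-identityʳ _) ⟩
        x ^ suc m
          ∎

  ^-p^suc : ∀ x i → x ^ (p ℕ.^ suc i) ≈ (x ^ (p ℕ.^ i)) ^ p
  ^-p^suc x i = trans (^-congʳ x (ℕ.*-comm p (p ℕ.^ i))) (sym (^-assocʳ x (p ℕ.^ i) p))

  frobenius-iterate : ∀ x y i → (x + y) ^ (p ℕ.^ i) ≈ x ^ (p ℕ.^ i) + y ^ (p ℕ.^ i)
  frobenius-iterate x y zero    = trans (*-identityʳ _) (sym (+-cong (*-identityʳ x) (*-identityʳ y)))
  frobenius-iterate x y (suc i) = begin
    (x + y) ^ (p ℕ.^ suc i)                          ≈⟨ ^-p^suc (x + y) i ⟩
    ((x + y) ^ (p ℕ.^ i)) ^ p                        ≈⟨ ^-congˡ p (frobenius-iterate x y i) ⟩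
    (x ^ (p ℕ.^ i) + y ^ (p ℕ.^ i)) ^ p              ≈⟨ frobenius _ _ ⟩
    (x ^ (p ℕ.^ i)) ^ p + (y ^ (p ℕ.^ i)) ^ p        ≈⟨ +-cong (^-p^suc x i) (^-p^suc y i) ⟨
    x ^ (p ℕ.^ suc i) + y ^ (p ℕ.^ suc i)            ∎

  ^-1 : ∀ k → 1# ^ k ≈ 1#
  ^-1 zero    = refl
  ^-1 (suc k) = trans (*-identityˡ _) (^-1 k)

  0^p≈0 : 0# ^ p ≈ 0#
  0^p≈0 = +-cancelˡ (0# ^ p) _ _ (begin
    0# ^ p + 0# ^ p   ≈⟨ frobenius 0# 0# ⟨
    (0# + 0#) ^ p     ≈⟨ ^-congˡ p (+-identityˡ 0#) ⟩
    0# ^ p            ≈⟨ +-identityʳ _ ⟨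
    0# ^ p + 0#       ∎)

  frobenius-sum : ∀ {m} (f : Fin m → Carrier) → sum f ^ p ≈ sum (λ i → f i ^ p)
  frobenius-sum {zero}  f = 0^p≈0
  frobenius-sum {suc m} f = trans (frobenius _ _) (+-congˡ (frobenius-sum (λ i → f (suc i))))

  ifZero : Carrier → Carrier → Carrier → Carrier
  ifZero a b y = if does (y ≟ 0#) then a else b

  ifZero-≈0 : ∀ {a b y} → y ≈ 0# → ifZero a b y ≈ a
  ifZero-≈0 {a} {b} {y} y≈0 = reflexive (≡.cong (if_then a else b) (dec-true (y ≟ 0#) y≈0))

  ifZero-≉0 : ∀ {a b y} → ¬ y ≈ 0# → ifZero a b y ≈ b
  ifZero-≉0 {a} {b} {y} y≉0 = reflexive (≡.cong (if_then a else b) (dec-false (y ≟ 0#) y≉0))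

  ifZero-cong : ∀ {a b c d y z} → (y ≈ 0# → a ≈ c) → (¬ y ≈ 0# → b ≈ d) → y ≈ z → ifZero a b y ≈ ifZero c d z
  ifZero-cong {y = y} a≈c b≈d y≈z with y ≟ 0#
  ... | yes y≈0 = trans (ifZero-≈0 y≈0) (trans (a≈c y≈0) (sym (ifZero-≈0 (trans (sym y≈z) y≈0))))
  ... | no y≉0  = trans (ifZero-≉0 y≉0) (trans (b≈d y≉0) (sym (ifZero-≉0 (λ z≈0 → y≉0 (trans y≈z z≈0)))))

  -- Multiplication by x permutes the nonzero elements, hence multiplies their
  -- product by x^{q-1} without changing it.
  fermat : ∀ x → x ^ q ≈ x
  fermat x with x ≟ 0#
  ... | yes x≈0 = trans (^-congˡ q x≈0) (trans (0^p^ n) (sym x≈0))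
    where
    0^p^ : ∀ k → 0# ^ (p ℕ.^ k) ≈ 0#
    0^p^ zero    = zeroˡ _
    0^p^ (suc k) = trans (^-p^suc 0# k) (trans (^-congˡ p (0^p^ k)) 0^p≈0)
  ... | no x≉0 = x∙y⁻¹≈ε⇒x≈y _ _ (*-cancel-≉0 P≉0 (begin
      P * (x ^ q - x)       ≈⟨ solve 3 (λ P y x → P :* (y :- x) := y :* P :- x :* P) refl P (x ^ q) x ⟩
      x ^ q * P - x * P     ≈⟨ +-congʳ x^qP≈xP ⟩
      x * P - x * P         ≈⟨ -‿inverseʳ _ ⟩
      0#                    ∎))
    where
    open Solver
    open Multiplicative renaming (∑ᶠ to ∏ᶠ; ∑ᶠ-cong to ∏ᶠ-cong; ∑ᶠ-single to ∏ᶠ-single)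
    module Product = MonoidSum *-commutativeMonoid

    -- Replacing 0 by 1 makes a product over the whole field equal to the product of the nonzero
    -- elements.
    nonzero : Carrier → Carrier
    nonzero y = ifZero 1# y y

    P = ∏ᶠ nonzero

    nonzero-≉0 : ∀ y → ¬ nonzero y ≈ 0#
    nonzero-≉0 y with y ≟ 0#
    ... | yes y≈0 = λ eq → 1≉0 (trans (sym (ifZero-≈0 y≈0)) eq)
    ... | no y≉0  = λ eq → y≉0 (trans (sym (ifZero-≉0 y≉0)) eq)

    product-≉0 : ∀ {m} (f : Fin m → Carrier) → (∀ i → ¬ f i ≈ 0#) → ¬ Product.sum f ≈ 0#
    product-≉0 {zero}  f f≉0 = 1≉0
    product-≉0 {suc m} f f≉0 eq = product-≉0 (λ i → f (suc i)) (λ i → f≉0 (suc i)) (*-cancel-≉0 (f≉0 zero) eq)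

    P≉0 : ¬ P ≈ 0#
    P≉0 = product-≉0 _ (λ i → nonzero-≉0 (element i))

    -- Of the q factors x, the one at `y ≈ 0#` is set apart and becomes the x on the right of
    -- `x^qP≈xP`; the others multiply the nonzero elements.
    split : ∀ y → x ≈ ifZero x 1# y * ifZero 1# x y
    split y with y ≟ 0#
    ... | yes y≈0 = sym (trans (*-cong (ifZero-≈0 y≈0) (ifZero-≈0 y≈0)) (*-identityʳ x))
    ... | no y≉0  = sym (trans (*-cong (ifZero-≉0 y≉0) (ifZero-≉0 y≉0)) (*-identityˡ x))

    nonzero-* : ∀ y → ifZero 1# x y * nonzero y ≈ nonzero (x * y)
    nonzero-* y with y ≟ 0#
    ... | yes y≈0 = trans (*-cong (ifZero-≈0 y≈0) (ifZero-≈0 y≈0))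
      (trans (*-identityˡ 1#) (sym (ifZero-≈0 (trans (*-congˡ y≈0) (zeroʳ x)))))
    ... | no y≉0  = trans (*-cong (ifZero-≉0 y≉0) (ifZero-≉0 y≉0))
      (sym (ifZero-≉0 (λ xy≈0 → y≉0 (*-cancel-≉0 x≉0 xy≈0))))

    x^qP≈xP : x ^ q * P ≈ x * P
    x^qP≈xP = begin
      x ^ q * P
        ≈⟨ *-congʳ (Product.sum-replicate q) ⟨
      ∏ᶠ (λ _ → x) * P
        ≈⟨ *-congʳ (trans (∏ᶠ-cong split) (Product.∑-distrib-+ {q} _ _)) ⟩
      ∏ᶠ (ifZero x 1#) * ∏ᶠ (ifZero 1# x) * P
        ≈⟨ trans (*-assoc _ _ _) (*-congˡ (sym (Product.∑-distrib-+ {q} _ _))) ⟩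
      ∏ᶠ (ifZero x 1#) * ∏ᶠ (λ y → ifZero 1# x y * nonzero y)
        ≈⟨ *-cong (∏ᶠ-single (ifZero-cong (λ _ → refl) (λ _ → refl)) 0# (λ y → ifZero-≉0)) (∏ᶠ-cong nonzero-*) ⟩
      ifZero x 1# 0# * ∏ᶠ (λ y → nonzero (x * y))
        ≈⟨ *-cong (ifZero-≈0 refl) (sym (scaling *-commutativeMonoid nonzero (λ y≈z → ifZero-cong (λ _ → refl) (λ _ → y≈z) y≈z) x≉0)) ⟩
      x * P
        ∎

  Tr-cong : ∀ {x y} → x ≈ y → Tr x ≈ Tr y
  Tr-cong x≈y = sum-cong-≋ {n} (λ i → ^-congˡ (p ℕ.^ toℕ i) x≈y)

  Tr-+ : ∀ x y → Tr (x + y) ≈ Tr x + Tr y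
  Tr-+ x y = trans (sum-cong-≋ {n} (λ i → frobenius-iterate x y (toℕ i))) (∑-distrib-+ {n} _ _)

  traceSum : ℕ → Carrier → Carrier
  traceSum m x = ∑[ i < m ] (x ^ (p ℕ.^ toℕ i))

  traceSum-suc : ∀ m x → traceSum (suc m) x ≈ traceSum m x + x ^ (p ℕ.^ m)
  traceSum-suc m x = trans (sum-init-last {m} (λ i → x ^ (p ℕ.^ toℕ i))) (+-cong
    (sum-cong-≋ {m} (λ i → reflexive (≡.cong (λ k → x ^ (p ℕ.^ k)) (toℕ-inject₁ i))))
    (reflexive (≡.cong (λ k → x ^ (p ℕ.^ k)) (toℕ-fromℕ m))))

  -- The p-th power raises every exponent p^i to p^(i+1). After x is added, both sides are x + x^p +
  -- ... + x^(p^n), the last term being x by Fermat.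
  Tr-^p : ∀ x → Tr x ^ p ≈ Tr x
  Tr-^p x = +-cancelˡ (x ^ 1) _ _ (begin
    x ^ 1 + Tr x ^ p                                    ≈⟨ +-congˡ (frobenius-sum {n} _) ⟩
    x ^ 1 + ∑[ i < n ] ((x ^ (p ℕ.^ toℕ i)) ^ p)        ≈⟨ +-congˡ (sum-cong-≋ {n} (λ i → ^-p^suc x (toℕ i))) ⟨
    traceSum (suc n) x                                  ≈⟨ traceSum-suc n x ⟩
    Tr x + x ^ q                                        ≈⟨ +-comm _ _ ⟩
    x ^ q + Tr x                                        ≈⟨ +-congʳ (trans (fermat x) (sym (*-identityʳ x))) ⟩
    x ^ 1 + Tr x                                        ∎)

  -- Bézout's identity for `d` and `p` would write 1 through d · 1 and p · 1, both of which would be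
  -- zero.
  ×1≉0 : ∀ d .{{_ : ℕ.NonZero d}} → d ℕ.< p → ¬ d ×ℕ 1# ≈ 0#
  ×1≉0 d d<p d≈0 with coprime-Bézout (prime⇒coprime p-prime d<p)
  ... | Bézout.+- x y eq = 1≉0 (begin
    1#                                  ≈⟨ trans (+-identityʳ _) (+-identityʳ _) ⟨
    1# + 0# + 0#                        ≈⟨ +-congˡ (trans (×1-homo-* y d) (trans (*-congˡ d≈0) (zeroʳ _))) ⟨
    1 ×ℕ 1# + (y ℕ.* d) ×ℕ 1#           ≈⟨ ×-homo-+ 1# 1 (y ℕ.* d) ⟨
    (1 ℕ.+ y ℕ.* d) ×ℕ 1#               ≡⟨ ≡.cong (_×ℕ 1#) eq ⟩
    (x ℕ.* p) ×ℕ 1#                     ≈⟨ trans (×1-homo-* x p) (trans (*-congˡ p×1≈0) (zeroʳ _)) ⟩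
    0#                                  ∎)
  ... | Bézout.-+ x y eq = 1≉0 (begin
    1#                                  ≈⟨ trans (+-identityʳ _) (+-identityʳ _) ⟨
    1# + 0# + 0#                        ≈⟨ +-congˡ (trans (×1-homo-* x p) (trans (*-congˡ p×1≈0) (zeroʳ _))) ⟨
    1 ×ℕ 1# + (x ℕ.* p) ×ℕ 1#           ≈⟨ ×-homo-+ 1# 1 (x ℕ.* p) ⟨
    (1 ℕ.+ x ℕ.* p) ×ℕ 1#               ≡⟨ ≡.cong (_×ℕ 1#) eq ⟩
    (y ℕ.* d) ×ℕ 1#                     ≈⟨ trans (×1-homo-* y d) (trans (*-congˡ d≈0) (zeroʳ _)) ⟩
    0#                                  ∎)

  ×1-injective : ∀ {k l} → k ℕ.< p → l ℕ.< p → k ×ℕ 1# ≈ l ×ℕ 1# → k ≡ l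
  ×1-injective {zero}  {zero}  _   _   _  = ≡.refl
  ×1-injective {zero}  {suc l} _   l<p eq = contradiction (sym eq) (×1≉0 (suc l) l<p)
  ×1-injective {suc k} {zero}  k<p _   eq = contradiction eq (×1≉0 (suc k) k<p)
  ×1-injective {suc k} {suc l} k<p l<p eq =
    ≡.cong suc (×1-injective (ℕ.<-trans (ℕ.n<1+n k) k<p) (ℕ.<-trans (ℕ.n<1+n l) l<p) (+-cancelˡ 1# _ _ eq))

  ×1-mod : ∀ k → k ×ℕ 1# ≈ (k % p) ×ℕ 1#
  ×1-mod k = begin
    k ×ℕ 1#                                     ≡⟨ ≡.cong (_×ℕ 1#) (m≡m%n+[m/n]*n k p) ⟩
    (k % p ℕ.+ k / p ℕ.* p) ×ℕ 1#               ≈⟨ ×-homo-+ 1# (k % p) _ ⟩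
    (k % p) ×ℕ 1# + (k / p ℕ.* p) ×ℕ 1#         ≈⟨ +-congˡ (p∣⇒×≈0 1# (divides (k / p) ≡.refl)) ⟩
    (k % p) ×ℕ 1# + 0#                          ≈⟨ +-identityʳ _ ⟩
    (k % p) ×ℕ 1#                               ∎

  ×1-≈⇒%-≡ : ∀ k l → k ×ℕ 1# ≈ l ×ℕ 1# → k % p ≡ l % p
  ×1-≈⇒%-≡ k l eq = ×1-injective (m%n<n k p) (m%n<n l p) (trans (sym (×1-mod k)) (trans eq (×1-mod l)))

  ×1-^p : ∀ k → (k ×ℕ 1#) ^ p ≈ k ×ℕ 1#
  ×1-^p zero    = 0^p≈0
  ×1-^p (suc k) = trans (frobenius 1# (k ×ℕ 1#)) (+-cong (^-1 p) (×1-^p k))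

  -- Xᵖ - X has no roots besides the p elements k · 1.
  prime-subfield : ∀ {t} → t ^ p ≈ t → ∃[ k ] toℕ {p} k ×ℕ 1# ≈ t
  prime-subfield {t} t^p≈t = decidable-stable (any? {n = p} (λ k → (toℕ k ×ℕ 1#) ≟ t)) λ none →
    let cs , eval-cs = X^p-X p p>1
    in roots≤degree 1≉0 *-cancel-≉0 cs root (root-injective none)
      (λ i → trans (eval-cs (root i)) (trans (+-congʳ (root-^p i)) (-‿inverseʳ _)))
    where
    root : Fin (suc p) → Carrier
    root zero    = t
    root (suc k) = toℕ k ×ℕ 1#

    root-^p : ∀ i → root i ^ p ≈ root i
    root-^p zero    = t^p≈t
    root-^p (suc k) = ×1-^p (toℕ k)

    root-injective : ¬ (∃[ k ] toℕ {p} k ×ℕ 1# ≈ t) → ∀ {i j} → root i ≈ root j → i ≡ j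
    root-injective none {zero}  {zero}  _  = ≡.refl
    root-injective none {zero}  {suc j} eq = contradiction (j , sym eq) none
    root-injective none {suc i} {zero}  eq = contradiction (i , eq) none
    root-injective none {suc i} {suc j} eq =
      ≡.cong suc (toℕ-injective (×1-injective (toℕ<n i) (toℕ<n j) eq))

    X^p-X : ∀ d → 1 ℕ.< d → MonicFunction d (λ x → x ^ d - x)
    X^p-X (suc (suc d)) _ = 0# ∷ (- 1#) ∷ replicate d 0# , λ x → begin
      0# + x * (- 1# + x * eval (replicate d 0#) x)  ≈⟨ +-identityˡ _ ⟩
      x * (- 1# + x * eval (replicate d 0#) x)       ≈⟨ *-congˡ (+-congˡ (*-congˡ (eval-zeros d x))) ⟩
      x * (- 1# + x * x ^ d)                         ≈⟨ distribˡ _ _ _ ⟩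
      x * - 1# + x * (x * x ^ d)                     ≈⟨ +-comm _ _ ⟩
      x * (x * x ^ d) + x * - 1#                     ≈⟨ +-congˡ (trans (sym (-‿distribʳ-* x 1#)) (-‿cong (*-identityʳ x))) ⟩
      x * (x * x ^ d) - x                            ∎
      where open Algebra.Properties.Ring ring using (-‿distribʳ-*)
    X^p-X (suc zero) (ℕ.s≤s ())

  residue-×1 : ∀ {t} → t ^ p ≈ t → residue t ×ℕ 1# ≈ t
  residue-×1 t^p≈t = Residue.residue-×1 𝔽 (prime-subfield t^p≈t)

  -- The trace is a monic polynomial function of degree p^(n-1) < q, so it cannot vanish at all q
  -- elements. The case n = 0 does not occur: a single element would make 1 and 0 equal.
  Tr-nontrivial : ∃[ i ] ¬ Tr (element i) ≈ 0#
  Tr-nontrivial = decidable-stable (any? (λ i → ¬? (Tr (element i) ≟ 0#))) λ none →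
    go n ≡.refl (λ i → decidable-stable (Tr (element i) ≟ 0#) (λ Tr≉0 → none (i , Tr≉0)))
    where
    monic : ∀ m → MonicFunction (p ℕ.^ m) (traceSum (suc m))
    monic zero    = let cs , eval≈ = monic-^ 1 in cs , λ x → trans (eval≈ x) (sym (+-identityʳ _))
    monic (suc m) = let cs , eval≈ = monic-+ (ℕ.^-monoʳ-< p p>1 (ℕ.n<1+n m)) (monic-^ (p ℕ.^ suc m)) (monic m)
      in cs , λ x → trans (eval≈ x) (trans (+-comm _ _) (sym (traceSum-suc (suc m) x)))

    go : ∀ m → m ≡ n → ¬ (∀ i → traceSum m (element i) ≈ 0#)
    go zero    0≡n _ = 1≉0 (trans (sym (Inverse.strictlyInverseˡ enumeration 1#))
      (trans (reflexive (≡.cong element (one-element 0≡n _ _))) (Inverse.strictlyInverseˡ enumeration 0#)))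
      where
      one-element : ∀ {m} → 0 ≡ m → (i j : Fin (p ℕ.^ m)) → i ≡ j
      one-element ≡.refl zero zero = ≡.refl
    go (suc m) m≡n Tr≈0 = roots≤degree 1≉0 *-cancel-≉0 (proj₁ (monic m))
      (λ i → element (inject≤ i d<q)) (λ eq → inject≤-injective d<q d<q _ _ (element-injective eq))
      (λ i → trans (proj₂ (monic m) _) (Tr≈0 _))
      where
      d<q : p ℕ.^ m ℕ.< q
      d<q = ≡.subst (λ k → p ℕ.^ m ℕ.< p ℕ.^ k) m≡n (ℕ.^-monoʳ-< p p>1 (ℕ.n<1+n m))

-- Additive characters and their orthogonality.

module ZeroIndicator {p n c ℓ} (𝔽 : FiniteField p n c ℓ) where
  open FiniteField 𝔽

  zero? : Carrier → ℕ
  zero? x = if does (x ≟ 0#) then 1 else 0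

  zero?-≈0 : ∀ {x} → x ≈ 0# → zero? x ≡ 1
  zero?-≈0 {x} x≈0 = ≡.cong (if_then 1 else 0) (dec-true (x ≟ 0#) x≈0)

  zero?-≉0 : ∀ {x} → ¬ x ≈ 0# → zero? x ≡ 0
  zero?-≉0 {x} x≉0 = ≡.cong (if_then 1 else 0) (dec-false (x ≟ 0#) x≉0)

  zero?≡1⇒≈0 : ∀ {x} → zero? x ≡ 1 → x ≈ 0#
  zero?≡1⇒≈0 {x} eq with x ≟ 0#
  ... | yes x≈0 = x≈0
  ... | no x≉0  = contradiction (≡.trans (≡.sym eq) (zero?-≉0 x≉0)) λ ()

  zero?-cong : ∀ {x y} → x ≈ y → zero? x ≡ zero? y
  zero?-cong {x} {y} x≈y with y ≟ 0#
  ... | yes y≈0 = ≡.trans (zero?-≈0 (trans x≈y y≈0)) (≡.sym (zero?-≈0 y≈0))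
  ... | no y≉0  = ≡.trans (zero?-≉0 (λ x≈0 → y≉0 (trans (sym x≈y) x≈0))) (≡.sym (zero?-≉0 y≉0))

module AdditiveCharacter {c ℓ r ℓ₁} (ℂ : ConjugationDomain r ℓ₁) {p n : ℕ} (p-prime : Prime p)
  (ζ : ConjugationDomain.Carrier ℂ)
  (ζ^p≈1 : ConjugationDomain._≈_ ℂ (ConjugationDomain._^_ ℂ ζ p) (ConjugationDomain.1# ℂ))
  (ζ^k≉1 : ∀ k → 0 ℕ.< k → k ℕ.< p → ¬ ConjugationDomain._≈_ ℂ (ConjugationDomain._^_ ℂ ζ k) (ConjugationDomain.1# ℂ))
  (𝔽 : FiniteField p n c ℓ) where

  module 𝔽 = FiniteField 𝔽
  module 𝔽ₚ = FieldFacts p-prime 𝔽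
  module ℂ = ConjugationDomain ℂ

  private
    instance
      p≢0 = prime⇒nonZero p-prime

  open FieldFacts p-prime 𝔽 using (q; Tr-cong; Tr-+; Tr-^p; Tr-nontrivial; residue-×1; shift; scaling)
  open ℂ hiding (zero; _^_)
  open Exp ℂ.commutativeSemiring
  open Mult ℂ.semiring using (×-homo-+) renaming (_×_ to _×ℕ_)
  open Mult 𝔽.semiring using () renaming (_×_ to _×𝔽_)
  open CyclotomicIntegers ℂ.commutativeRing torsionFree 1≉0 p ζ ζ^p≈1 public
    using (ℤ[ζ]; ℤ[ζ]-resp; ℤ[ζ]-+; ℤ[ζ]-*; ℤ[ζ]-sum; ℤ[ζ]-scale; ℤ[ζ]-^; ^-mod; 1+2z≉0)
  open CharacteristicZero commutativeRing torsionFree 1≉0 public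
  open FieldSums 𝔽 ℂ.+-commutativeMonoid public
  open ZeroIndicator 𝔽 public
  open Sum ℂ.semiring using (*-distribʳ-sum; sum-replicate)
  open Algebra.Properties.Ring ℂ.ring using (x∙y⁻¹≈ε⇒x≈y)
  open SetoidReasoning setoid

  -- Equality of the multiples of 1 in the field determines the exponents modulo p, so any
  -- representative of a trace gives the same character value.
  ζ^-≈ : ∀ k l → k ×𝔽 𝔽.1# 𝔽.≈ l ×𝔽 𝔽.1# → ζ ^ k ≈ ζ ^ l
  ζ^-≈ k l eq = trans (^-mod k) (trans (reflexive (≡.cong (ζ ^_) (𝔽ₚ.×1-≈⇒%-≡ k l eq))) (sym (^-mod l)))

  exponent : 𝔽.Carrier → ℕ
  exponent x = 𝔽.residue (𝔽.Tr x)

  χ : 𝔽.Carrier → Carrier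
  χ x = ζ ^ exponent x

  -- The element `t` is kept apart from `Tr x` because `Walsh` takes the residue of a difference of
  -- traces, which equals a trace only up to `≈`.
  residue-Tr : ∀ {t} x → t 𝔽.≈ 𝔽.Tr x → 𝔽.residue t ×𝔽 𝔽.1# 𝔽.≈ 𝔽.Tr x
  residue-Tr x t≈ = 𝔽.trans (residue-×1 (𝔽.trans (𝔽-Exp.^-congˡ p t≈) (𝔽.trans (Tr-^p x) (𝔽.sym t≈)))) t≈
    where module 𝔽-Exp = Exp 𝔽.commutativeSemiring

  χ-unique : ∀ k x → k ×𝔽 𝔽.1# 𝔽.≈ 𝔽.Tr x → ζ ^ k ≈ χ x
  χ-unique k x eq = ζ^-≈ k (exponent x) (𝔽.trans eq (𝔽.sym (residue-Tr x 𝔽.refl)))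

  ζ^residue≈χ : ∀ {t} x → t 𝔽.≈ 𝔽.Tr x → ζ ^ 𝔽.residue t ≈ χ x
  ζ^residue≈χ {t} x t≈ = χ-unique (𝔽.residue t) x (residue-Tr x t≈)

  χ-cong : ∀ {x y} → x 𝔽.≈ y → χ x ≈ χ y
  χ-cong {x} {y} x≈y = ζ^residue≈χ y (Tr-cong x≈y)

  χ-+ : ∀ x y → χ (x 𝔽.+ y) ≈ χ x * χ y
  χ-+ x y = trans (sym (χ-unique (exponent x ℕ.+ exponent y) (x 𝔽.+ y)
    (𝔽.trans (𝔽-Mult.×-homo-+ 𝔽.1# (exponent x) (exponent y))
      (𝔽.trans (𝔽.+-cong (residue-Tr x 𝔽.refl) (residue-Tr y 𝔽.refl)) (𝔽.sym (Tr-+ x y))))))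
    (^-homo-* ζ (exponent x) (exponent y))
    where module 𝔽-Mult = Mult 𝔽.semiring

  Tr-0 : 𝔽.Tr 𝔽.0# 𝔽.≈ 𝔽.0#
  Tr-0 = 𝔽-Ring.+-cancelˡ (𝔽.Tr 𝔽.0#) _ _ (𝔽.trans (𝔽.sym (Tr-+ 𝔽.0# 𝔽.0#))
    (𝔽.trans (Tr-cong (𝔽.+-identityˡ 𝔽.0#)) (𝔽.sym (𝔽.+-identityʳ _))))
    where module 𝔽-Ring = Algebra.Properties.Ring 𝔽.ring

  Tr-∸ : ∀ x y → 𝔽.Tr x 𝔽.- 𝔽.Tr y 𝔽.≈ 𝔽.Tr (x 𝔽.- y)
  Tr-∸ x y = 𝔽-Ring.+-cancelʳ (𝔽.Tr y) _ _ (𝔽.trans (cancel (𝔽.Tr x) (𝔽.Tr y))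
    (𝔽.trans (Tr-cong (𝔽.sym (cancel x y))) (Tr-+ (x 𝔽.- y) y)))
    where
    module 𝔽-Ring = Algebra.Properties.Ring 𝔽.ring
    open IntegerImage 𝔽.commutativeRing
    open Solver
    cancel : ∀ x y → x 𝔽.- y 𝔽.+ y 𝔽.≈ x
    cancel = solve 2 (λ x y → x :- y :+ y := x) 𝔽.refl

  χ-0 : ∀ {x} → x 𝔽.≈ 𝔽.0# → χ x ≈ 1#
  χ-0 {x} x≈0 = sym (χ-unique 0 x (𝔽.sym (𝔽.trans (Tr-cong x≈0) Tr-0)))

  -- Both sides are inverse to `χ x`: the left one since `χ x` is a root of unity, the right one
  -- since χ turns sums into products.
  χ-conj : ∀ x → conj (χ x) ≈ χ (𝔽.- x)
  χ-conj x = begin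
    conj (χ x)                        ≈⟨ *-identityʳ _ ⟨
    conj (χ x) * 1#                   ≈⟨ *-congˡ (trans (sym (χ-+ x (𝔽.- x))) (χ-0 (𝔽.-‿inverseʳ x))) ⟨
    conj (χ x) * (χ x * χ (𝔽.- x))    ≈⟨ trans (sym (*-assoc _ _ _)) (*-congʳ (trans (*-comm _ _) χ*conjχ≈1)) ⟩
    1# * χ (𝔽.- x)                    ≈⟨ *-identityˡ _ ⟩
    χ (𝔽.- x)                         ∎
    where
    k = exponent x

    χ*conjχ≈1 : χ x * conj (χ x) ≈ 1#
    χ*conjχ≈1 = root-of-unity-*-conj (χ x) p (begin
      (ζ ^ k) ^ p        ≈⟨ ^-assocʳ ζ k p ⟩
      ζ ^ (k ℕ.* p)      ≡⟨ ≡.cong (ζ ^_) (ℕ.*-comm k p) ⟩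
      ζ ^ (p ℕ.* k)      ≈⟨ ^-assocʳ ζ p k ⟨
      (ζ ^ p) ^ k        ≈⟨ ^-congˡ k ζ^p≈1 ⟩
      1# ^ k             ≈⟨ 1^ k ⟩
      1#                 ∎)
      where
      1^ : ∀ k → 1# ^ k ≈ 1#
      1^ zero    = refl
      1^ (suc k) = trans (*-identityˡ _) (1^ k)

  -- At an element of nonzero trace the exponent is not a multiple of p, and ζ is primitive.
  χ-nontrivial : ∃[ x ] ¬ χ x ≈ 1#
  χ-nontrivial = let i , Tr≉0 = Tr-nontrivial ; x = 𝔽.element i ; k = exponent x in
    x , λ χ≈1 → ζ^k≉1 (k % p)
      (ℕ.n≢0⇒n>0 (λ k%p≡0 → Tr≉0 (𝔽.trans (𝔽.sym (residue-Tr x 𝔽.refl))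
        (𝔽.trans (𝔽ₚ.×1-mod k) (𝔽.reflexive (≡.cong (_×𝔽 𝔽.1#) k%p≡0))))))
      (m%n<n k p) (trans (sym (^-mod k)) χ≈1)

  ∑ᶠ-1 : ∑ᶠ (λ _ → 1#) ≈ q ×ℕ 1#
  ∑ᶠ-1 = sum-replicate q

  -- Translation by an `x` with `χ x` different from 1 preserves the sum and also multiplies it by
  -- `χ x`.
  ∑ᶠ-χ : ∑ᶠ χ ≈ 0#
  ∑ᶠ-χ = *-cancel-≉0 (λ eq → χx≉1 (x∙y⁻¹≈ε⇒x≈y _ _ eq)) (begin
    (χ x - 1#) * ∑ᶠ χ            ≈⟨ solve 3 (λ c o s → (c :- o) :* s := s :* c :- o :* s) refl (χ x) 1# (∑ᶠ χ) ⟩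
    ∑ᶠ χ * χ x - 1# * ∑ᶠ χ       ≈⟨ +-cong invariant (-‿cong (*-identityˡ _)) ⟩
    ∑ᶠ χ - ∑ᶠ χ                  ≈⟨ -‿inverseʳ _ ⟩
    0#                           ∎)
    where
    open IntegerImage commutativeRing
    open Solver
    x = proj₁ χ-nontrivial
    χx≉1 = proj₂ χ-nontrivial

    invariant : ∑ᶠ χ * χ x ≈ ∑ᶠ χ
    invariant = begin
      ∑ᶠ χ * χ x                       ≈⟨ *-distribʳ-sum {q} _ _ ⟩
      ∑ᶠ (λ y → χ y * χ x)             ≈⟨ ∑ᶠ-cong (λ y → χ-+ y x) ⟨
      ∑ᶠ (λ y → χ (y 𝔽.+ x))           ≈⟨ shift ℂ.+-commutativeMonoid χ χ-cong x ⟨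
      ∑ᶠ χ                             ∎

  orthogonality : ∀ x → ∑ᶠ (λ b → χ (b 𝔽.* x)) ≈ (q ℕ.* zero? x) ×ℕ 1#
  orthogonality x with x 𝔽.≟ 𝔽.0#
  ... | yes x≈0 = begin
    ∑ᶠ (λ b → χ (b 𝔽.* x))    ≈⟨ ∑ᶠ-cong (λ b → χ-0 (𝔽.trans (𝔽.*-congˡ x≈0) (𝔽.zeroʳ b))) ⟩
    ∑ᶠ (λ _ → 1#)             ≈⟨ ∑ᶠ-1 ⟩
    q ×ℕ 1#                   ≡⟨ ≡.cong (_×ℕ 1#) (≡.trans (≡.sym (ℕ.*-identityʳ q)) (≡.cong (q ℕ.*_) (≡.sym (zero?-≈0 x≈0)))) ⟩
    (q ℕ.* zero? x) ×ℕ 1#     ∎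
  ... | no x≉0  = begin
    ∑ᶠ (λ b → χ (b 𝔽.* x))    ≈⟨ ∑ᶠ-cong (λ b → χ-cong (𝔽.*-comm b x)) ⟩
    ∑ᶠ (λ b → χ (x 𝔽.* b))    ≈⟨ scaling ℂ.+-commutativeMonoid χ χ-cong x≉0 ⟨
    ∑ᶠ χ                      ≈⟨ ∑ᶠ-χ ⟩
    0#                        ≡⟨ ≡.cong (_×ℕ 1#) (≡.trans (≡.sym (ℕ.*-zeroʳ q)) (≡.cong (q ℕ.*_) (≡.sym (zero?-≉0 x≉0)))) ⟩
    (q ℕ.* zero? x) ×ℕ 1#     ∎

-- Counting with sums of natural numbers.

module ℕ-Sum = Sum ℕ.+-*-semiring

indicator : ∀ {a} {A : Set a} → Dec A → ℕ
indicator A? = if does A? then 1 else 0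

length-filter-tabulate : ∀ {a b} {A : Set a} {P : A → Set b} (P? : Decidable P) {n} (f : Fin n → A) →
  length (filter P? (tabulate f)) ≡ ℕ-Sum.sum (λ i → indicator (P? (f i)))
length-filter-tabulate P? {zero}  f = ≡.refl
length-filter-tabulate P? {suc n} f with does (P? (f zero))
... | true  = ≡.cong suc (length-filter-tabulate P? (λ i → f (suc i)))
... | false = length-filter-tabulate P? (λ i → f (suc i))

sum-mono-≤ : ∀ {n} (f g : Fin n → ℕ) → (∀ i → f i ℕ.≤ g i) → ℕ-Sum.sum f ℕ.≤ ℕ-Sum.sum g
sum-mono-≤ {zero}  f g f≤g = ℕ.z≤n
sum-mono-≤ {suc n} f g f≤g = ℕ.+-mono-≤ (f≤g zero) (sum-mono-≤ _ _ (λ i → f≤g (suc i)))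

+-≡-mono-≤ : ∀ {a b c d} → a ℕ.≤ c → b ℕ.≤ d → a ℕ.+ b ≡ c ℕ.+ d → a ≡ c × b ≡ d
+-≡-mono-≤ {a} {b} {c} {d} a≤c b≤d eq = a≡c , ℕ.+-cancelˡ-≡ c b d (≡.trans (≡.cong (ℕ._+ b) (≡.sym a≡c)) eq)
  where
  a≡c : a ≡ c
  a≡c with ℕ.m≤n⇒m<n∨m≡n a≤c
  ... | inj₁ a<c = contradiction eq (ℕ.<⇒≢ (ℕ.+-mono-<-≤ a<c b≤d))
  ... | inj₂ a≡c = a≡c

-- The rigidity behind the three counting steps: for the fibre sizes, for the values `V b 0` as b
-- varies, and for the values `V b a` at a fixed b.
sum-≤-≡ : ∀ {n} (f g : Fin n → ℕ) → (∀ i → f i ℕ.≤ g i) → ℕ-Sum.sum f ≡ ℕ-Sum.sum g → ∀ i → f i ≡ g i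
sum-≤-≡ {suc n} f g f≤g eq i
  with +-≡-mono-≤ (f≤g zero) (sum-mono-≤ _ _ (λ i → f≤g (suc i))) eq
sum-≤-≡ {suc n} f g f≤g eq zero    | eq₀ , _   = eq₀
sum-≤-≡ {suc n} f g f≤g eq (suc i) | _   , eq₊ = sum-≤-≡ _ _ (λ i → f≤g (suc i)) eq₊ i

sum≡0⇒≡0 : ∀ {n} (f : Fin n → ℕ) → ℕ-Sum.sum f ≡ 0 → ∀ i → f i ≡ 0
sum≡0⇒≡0 {suc n} f eq zero    = ℕ.m+n≡0⇒m≡0 (f zero) eq
sum≡0⇒≡0 {suc n} f eq (suc i) = sum≡0⇒≡0 (λ i → f (suc i)) (ℕ.m+n≡0⇒n≡0 (f zero) eq) i

sum≡1⇒single : ∀ {n} (f : Fin n → ℕ) → ℕ-Sum.sum f ≡ 1 → ∃[ i ] f i ≡ 1 × (∀ j → j ≢ i → f j ≡ 0)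
sum≡1⇒single {suc n} f eq with f zero in f₀
... | suc zero    = zero , f₀ , λ where
  zero    0≢0 → contradiction ≡.refl 0≢0
  (suc j) _   → sum≡0⇒≡0 (λ i → f (suc i)) (ℕ.suc-injective eq) j
... | zero        = let i , fi≡1 , rest = sum≡1⇒single (λ i → f (suc i)) eq in
  suc i , fi≡1 , λ where
    zero    _    → f₀
    (suc j) j≢i → rest j (λ j≡i → j≢i (≡.cong suc j≡i))

module NaturalSums {r ℓ} (S : Semiring r ℓ) where
  open Semiring S hiding (zero)
  open Mult S using (×-homo-+) renaming (_×_ to _×ℕ_)
  open Sum S

  sum-×1 : ∀ {n} (f : Fin n → ℕ) → sum (λ i → f i ×ℕ 1#) ≈ ℕ-Sum.sum f ×ℕ 1#
  sum-×1 {zero}  f = refl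
  sum-×1 {suc n} f = trans (+-congˡ (sum-×1 (λ i → f (suc i)))) (sym (×-homo-+ 1# (f zero) _))

-- Makes the rounded division in `TwoToOne` exact: the remainder modulo 2 is 1, and `∸ 1` removes
-- it.
odd-half : ∀ {m} → 2 ∤ m → m ≡ 1 ℕ.+ 2 ℕ.* ((m ℕ.∸ 1) / 2)
odd-half {m} 2∤m with m % 2 in m%2 | m≡m%n+[m/n]*n m 2 | m%n<n m 2
... | zero        | _  | _ = contradiction (m%n≡0⇒n∣m m 2 m%2) 2∤m
... | suc (suc _) | _  | ℕ.s≤s (ℕ.s≤s ())
... | suc zero    | eq | _ = begin
  m                                           ≡⟨ eq ⟩
  1 ℕ.+ m / 2 ℕ.* 2                           ≡⟨ ≡.cong suc (ℕ.*-comm (m / 2) 2) ⟩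
  1 ℕ.+ 2 ℕ.* (m / 2)                         ≡⟨ ≡.cong (λ k → 1 ℕ.+ 2 ℕ.* k) (m*n/n≡m (m / 2) 2) ⟨
  1 ℕ.+ 2 ℕ.* (m / 2 ℕ.* 2 / 2)               ≡⟨ ≡.cong (λ k → 1 ℕ.+ 2 ℕ.* ((k ℕ.∸ 1) / 2)) eq ⟨
  1 ℕ.+ 2 ℕ.* ((m ℕ.∸ 1) / 2)                 ∎
  where open ≡.≡-Reasoning

odd-^ : ∀ {m} → 2 ∤ m → ∀ n → 2 ∤ m ℕ.^ n
odd-^ 2∤m zero    2∣1 = contradiction (∣⇒≤ 2∣1) (ℕ.<⇒≱ (ℕ.n<1+n 1))
odd-^ {m} 2∤m (suc n) 2∣m^n = [ 2∤m , odd-^ 2∤m n ]′ (euclidsLemma m (m ℕ.^ n) prime[2] 2∣m^n)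

-- Fibres of a 2-to-1 function.

module Preimages {p n c ℓ} (𝔽 : FiniteField p n c ℓ) (F : Func (FiniteField.setoid 𝔽) (FiniteField.setoid 𝔽)) where
  open FiniteField 𝔽 hiding (zero; sum; _×ℕ_)
  open Func F using () renaming (to to f; cong to f-cong)
  open ZeroIndicator 𝔽
  open Algebra.Properties.Ring ring using (x∙y⁻¹≈ε⇒x≈y)
  private
    module ℕᶠ = FieldSums 𝔽 ℕ.+-0-commutativeMonoid

  -- The number `#preimages` as a sum of `zero?`, which is the form in which orthogonality of
  -- characters yields it.
  count : Carrier → ℕ
  count y = ℕᶠ.∑ᶠ (λ x → zero? (f x - y))

  -‿cong₂ : ∀ {x y u v} → x ≈ y → u ≈ v → x - u ≈ y - v
  -‿cong₂ x≈y u≈v = +-cong x≈y (-‿cong u≈v)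

  count-cong : ∀ {y z} → y ≈ z → count y ≡ count z
  count-cong y≈z = ℕᶠ.∑ᶠ-cong (λ x → zero?-cong (-‿cong₂ (refl {f x}) y≈z))

  indicator-≟ : ∀ x y → indicator (x ≟ y) ≡ zero? (x - y)
  indicator-≟ x y with x ≟ y
  ... | yes x≈y = ≡.trans (≡.cong (if_then 1 else 0) (dec-true (x ≟ y) x≈y))
    (≡.sym (zero?-≈0 (trans (-‿cong₂ x≈y refl) (-‿inverseʳ y))))
  ... | no x≉y  = ≡.trans (≡.cong (if_then 1 else 0) (dec-false (x ≟ y) x≉y))
    (≡.sym (zero?-≉0 (λ x-y≈0 → x≉y (x∙y⁻¹≈ε⇒x≈y x y x-y≈0))))

  #preimages≡count : ∀ y → #preimages 𝔽 F y ≡ count y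
  #preimages≡count y = ≡.trans (length-filter-tabulate (λ x → f x ≟ y) element)
    (ℕᶠ.∑ᶠ-cong (λ x → indicator-≟ (f x) y))

  #withPreimages≡ : ∀ k → #withPreimages 𝔽 F k ≡ ℕᶠ.∑ᶠ (λ y → indicator (count y ℕ.≟ k))
  #withPreimages≡ k = ≡.trans (length-filter-tabulate (λ y → #preimages 𝔽 F y ℕ.≟ k) element)
    (ℕᶠ.∑ᶠ-cong (λ y → ≡.cong (λ m → indicator (m ℕ.≟ k)) (#preimages≡count y)))

  module _ {r ℓ′} (S : Semiring r ℓ′) where
    private
      module S = Semiring S
    open Mult S using () renaming (_×_ to _×ℕ_)
    open Sum S
    open FieldSums 𝔽 S.+-commutativeMonoid
    open SetoidReasoning S.setoid

    -- Insert the sum over `y` of the indicator of `f x ≈ y`, which is 1, and exchange the two sums.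
    -- It is used over ℕ for the fibre sizes and over ℂ for W(b,0).
    ∑ᶠ-pushforward : (g : Carrier → S.Carrier) → (∀ {y z} → y ≈ z → g y S.≈ g z) →
      ∑ᶠ (λ x → g (f x)) S.≈ ∑ᶠ (λ y → count y ×ℕ S.1# S.* g y)
    ∑ᶠ-pushforward g g-cong = begin
      ∑ᶠ (λ x → g (f x))
        ≈⟨ ∑ᶠ-cong fibre ⟨
      ∑ᶠ (λ x → ∑ᶠ (λ y → weight x y S.* g y))
        ≈⟨ ∑-comm {p ℕ.^ n} {p ℕ.^ n} _ ⟩
      ∑ᶠ (λ y → ∑ᶠ (λ x → weight x y S.* g y))
        ≈⟨ ∑ᶠ-cong (λ y → S.trans (S.sym (*-distribʳ-sum {p ℕ.^ n} (g y) _)) (S.*-congʳ (NaturalSums.sum-×1 S {p ℕ.^ n} (λ i → zero? (f (element i) - y))))) ⟩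
      ∑ᶠ (λ y → count y ×ℕ S.1# S.* g y)
        ∎
      where
      weight : Carrier → Carrier → S.Carrier
      weight x y = zero? (f x - y) ×ℕ S.1#

      fibre : ∀ x → ∑ᶠ (λ y → weight x y S.* g y) S.≈ g (f x)
      fibre x = begin
        ∑ᶠ (λ y → weight x y S.* g y)
          ≈⟨ ∑ᶠ-single (λ y≈z → S.*-cong (S.reflexive (≡.cong (_×ℕ S.1#) (zero?-cong (-‿cong₂ refl y≈z)))) (g-cong y≈z)) (f x)
              (λ y y≉fx → S.trans (S.*-congʳ (S.reflexive (≡.cong (_×ℕ S.1#) (zero?-≉0 (λ eq → y≉fx (sym (x∙y⁻¹≈ε⇒x≈y _ _ eq))))))) (S.zeroˡ _)) ⟩
        weight x (f x) S.* g (f x)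
          ≈⟨ S.*-congʳ (S.trans (S.reflexive (≡.cong (_×ℕ S.1#) (zero?-≈0 (-‿inverseʳ (f x))))) (S.+-identityʳ S.1#)) ⟩
        S.1# S.* g (f x)
          ≈⟨ S.*-identityˡ _ ⟩
        g (f x) ∎

  one two : Carrier → ℕ
  one y = indicator (count y ℕ.≟ 1)
  two y = indicator (count y ℕ.≟ 2)

  -- The number of ordered pairs with equal images.
  collisions : ℕ
  collisions = ℕᶠ.∑ᶠ (λ x → count (f x))

  ∑const : ∀ k → ℕᶠ.∑ᶠ (λ _ → k) ≡ (p ℕ.^ n) ℕ.* k
  ∑const k = go (p ℕ.^ n)
    where
    go : ∀ m → ℕ-Sum.sum {m} (λ _ → k) ≡ m ℕ.* k
    go zero    = ≡.refl
    go (suc m) = ≡.cong (k ℕ.+_) (go m)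

  -- Lower bound for |W(b,0)|²: it is q for b ≠ 0, and q² for b = 0.
  bound : Carrier → ℕ
  bound b = q ℕ.+ zero? b ℕ.* (q ℕ.* q ℕ.∸ q)
    where q = p ℕ.^ n

  module _ (2∤p : 2 ∤ p) (twoToOne : TwoToOne 𝔽 F) where
    open ≡.≡-Reasoning
    private
      q = p ℕ.^ n
      h = (q ℕ.∸ 1) / 2

      ×1≡ : ∀ k → Mult._×_ ℕ.+-*-semiring k 1 ≡ k
      ×1≡ zero    = ≡.refl
      ×1≡ (suc k) = ≡.cong suc (×1≡ k)

      pushforward : (g : Carrier → ℕ) → (∀ {y z} → y ≈ z → g y ≡ g z) →
        ℕᶠ.∑ᶠ (λ x → g (f x)) ≡ ℕᶠ.∑ᶠ (λ y → count y ℕ.* g y)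
      pushforward g g-cong = ≡.trans (∑ᶠ-pushforward ℕ.+-*-semiring g g-cong)
        (ℕᶠ.∑ᶠ-cong (λ y → ≡.cong (ℕ._* g y) (×1≡ (count y))))

      ∑one+ : ∀ k → ℕᶠ.∑ᶠ (λ y → one y ℕ.+ k ℕ.* two y) ≡ 1 ℕ.+ k ℕ.* h
      ∑one+ k = begin
        ℕᶠ.∑ᶠ (λ y → one y ℕ.+ k ℕ.* two y)
          ≡⟨ ℕ-Sum.∑-distrib-+ {q} _ _ ⟩
        ℕᶠ.∑ᶠ one ℕ.+ ℕᶠ.∑ᶠ (λ y → k ℕ.* two y)
          ≡⟨ ≡.cong₂ ℕ._+_ ∑one (≡.trans (≡.sym (ℕ-Sum.*-distribˡ-sum {q} k _)) (≡.cong (k ℕ.*_) ∑two)) ⟩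
        1 ℕ.+ k ℕ.* h
          ∎
        where
        ∑two : ℕᶠ.∑ᶠ two ≡ h
        ∑two = ≡.trans (≡.sym (#withPreimages≡ 2)) (proj₂ twoToOne)
        ∑one : ℕᶠ.∑ᶠ one ≡ 1
        ∑one = ≡.trans (≡.sym (#withPreimages≡ 1)) (proj₁ twoToOne)

      ∑count : ℕᶠ.∑ᶠ count ≡ q
      ∑count = begin
        ℕᶠ.∑ᶠ count                         ≡⟨ ℕᶠ.∑ᶠ-cong (λ y → ℕ.*-identityʳ (count y)) ⟨
        ℕᶠ.∑ᶠ (λ y → count y ℕ.* 1)         ≡⟨ pushforward (λ _ → 1) (λ _ → ≡.refl) ⟨
        ℕᶠ.∑ᶠ (λ _ → 1)                     ≡⟨ ℕ-Sum.sum-replicate q ⟩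
        Mult._×_ ℕ.+-*-semiring q 1         ≡⟨ ×1≡ q ⟩
        q                                   ∎

      -- A fibre of size k ≤ 2 has `weigh 2 k` elements and `weigh 4 k` ordered pairs of elements; a
      -- larger one gets weight 0.
      weigh : ℕ → ℕ → ℕ
      weigh l k = indicator (k ℕ.≟ 1) ℕ.+ l ℕ.* indicator (k ℕ.≟ 2)

      weigh-2≤ : ∀ k → weigh 2 k ℕ.≤ k
      weigh-2≤ 0 = ℕ.z≤n
      weigh-2≤ 1 = ℕ.≤-refl
      weigh-2≤ 2 = ℕ.≤-refl
      weigh-2≤ (suc (suc (suc _))) = ℕ.z≤n

      square≡weigh-4 : ∀ k → weigh 2 k ≡ k → k ℕ.* k ≡ weigh 4 k
      square≡weigh-4 0 _ = ≡.refl
      square≡weigh-4 1 _ = ≡.refl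
      square≡weigh-4 2 _ = ≡.refl
      square≡weigh-4 (suc (suc (suc _))) ()

    q≡1+2h : q ≡ 1 ℕ.+ 2 ℕ.* h
    q≡1+2h = odd-half (odd-^ 2∤p n)

    -- `TwoToOne` counts the fibres of sizes 1 and 2 and leaves the other sizes open. The counted
    -- fibres already contain 1 + 2h = q points, the whole domain, so all other fibres are empty.
    count≡ : ∀ i → let y = element i in one y ℕ.+ 2 ℕ.* two y ≡ count y
    count≡ = sum-≤-≡ _ _ (λ i → weigh-2≤ (count (element i)))
      (≡.trans (∑one+ 2) (≡.trans (≡.sym q≡1+2h) (≡.sym ∑count)))

    -- One fibre contributes 1 pair and `h` fibres contribute 4 each, so there are 1 + 4h = 2q - 1
    -- pairs.
    1+collisions : 1 ℕ.+ collisions ≡ 2 ℕ.* q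
    1+collisions = begin
      1 ℕ.+ collisions                                ≡⟨ ≡.cong suc (pushforward count count-cong) ⟩
      1 ℕ.+ ℕᶠ.∑ᶠ (λ y → count y ℕ.* count y)         ≡⟨ ≡.cong suc (ℕ-Sum.sum-cong-≗ {q} (λ i → square≡weigh-4 _ (count≡ i))) ⟩
      1 ℕ.+ ℕᶠ.∑ᶠ (λ y → one y ℕ.+ 4 ℕ.* two y)       ≡⟨ ≡.cong suc (∑one+ 4) ⟩
      2 ℕ.+ 4 ℕ.* h                                   ≡⟨ ≡.cong (2 ℕ.+_) (ℕ.*-assoc 2 2 h) ⟩
      2 ℕ.+ 2 ℕ.* (2 ℕ.* h)                           ≡⟨ ℕ.*-distribˡ-+ 2 1 (2 ℕ.* h) ⟨
      2 ℕ.* (1 ℕ.+ 2 ℕ.* h)                           ≡⟨ ≡.cong (2 ℕ.*_) q≡1+2h ⟨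
      2 ℕ.* q                                         ∎

    one-single : ∃[ i ] one (element i) ≡ 1 × (∀ j → j ≢ i → one (element j) ≡ 0)
    one-single = sum≡1⇒single _ (≡.trans (≡.sym (#withPreimages≡ 1)) (proj₁ twoToOne))

    q≤q*q : q ℕ.≤ q ℕ.* q
    q≤q*q = ℕ.m≤m*n q q {{≡.subst ℕ.NonZero (≡.sym q≡1+2h) _}}

    -- Both sides are 2q² - q: on the left q - 1 entries q and one entry q², on the right q(2q - 1).
    -- Adding q to both sides cancels the truncated subtraction inside `bound`.
    ∑bound : ℕᶠ.∑ᶠ bound ≡ q ℕ.* collisions
    ∑bound = ℕ.+-cancelˡ-≡ q _ _ (begin
      q ℕ.+ ℕᶠ.∑ᶠ bound
        ≡⟨ ≡.cong (q ℕ.+_) (ℕ-Sum.∑-distrib-+ {q} _ _) ⟩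
      q ℕ.+ (ℕᶠ.∑ᶠ (λ _ → q) ℕ.+ ℕᶠ.∑ᶠ (λ b → zero? b ℕ.* (q ℕ.* q ℕ.∸ q)))
        ≡⟨ ≡.cong₂ (λ k l → q ℕ.+ (k ℕ.+ l)) (∑const q) excess ⟩
      q ℕ.+ (q ℕ.* q ℕ.+ (q ℕ.* q ℕ.∸ q))
        ≡⟨ ≡.cong (q ℕ.+_) (ℕ.+-comm (q ℕ.* q) _) ⟩
      q ℕ.+ ((q ℕ.* q ℕ.∸ q) ℕ.+ q ℕ.* q)
        ≡⟨ ℕ.+-assoc q _ _ ⟨
      q ℕ.+ (q ℕ.* q ℕ.∸ q) ℕ.+ q ℕ.* q
        ≡⟨ ≡.cong (ℕ._+ q ℕ.* q) (ℕ.m+[n∸m]≡n q≤q*q) ⟩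
      q ℕ.* q ℕ.+ q ℕ.* q
        ≡⟨ ℕ.*-distribˡ-+ q q q ⟨
      q ℕ.* (q ℕ.+ q)
        ≡⟨ ≡.cong (λ k → q ℕ.* (q ℕ.+ k)) (ℕ.+-identityʳ q) ⟨
      q ℕ.* (2 ℕ.* q)
        ≡⟨ ≡.cong (q ℕ.*_) 1+collisions ⟨
      q ℕ.* suc collisions
        ≡⟨ ℕ.*-suc q collisions ⟩
      q ℕ.+ q ℕ.* collisions
        ∎)
      where
      excess : ℕᶠ.∑ᶠ (λ b → zero? b ℕ.* (q ℕ.* q ℕ.∸ q)) ≡ q ℕ.* q ℕ.∸ q
      excess = ≡.trans
        (ℕᶠ.∑ᶠ-single (λ x≈y → ≡.cong (ℕ._* (q ℕ.* q ℕ.∸ q)) (zero?-cong x≈y)) 0# (λ y y≉0 → ≡.cong (ℕ._* (q ℕ.* q ℕ.∸ q)) (zero?-≉0 y≉0)))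
        (≡.trans (≡.cong (ℕ._* (q ℕ.* q ℕ.∸ q)) (zero?-≈0 refl)) (ℕ.+-identityʳ _))

-- The Walsh transform and planarity.

module WalshTransform {c ℓ r ℓ₁} (ℂ : ConjugationDomain r ℓ₁) {p n : ℕ} (p-prime : Prime p)
  (ζ : ConjugationDomain.Carrier ℂ)
  (ζ^p≈1 : ConjugationDomain._≈_ ℂ (ConjugationDomain._^_ ℂ ζ p) (ConjugationDomain.1# ℂ))
  (ζ^k≉1 : ∀ k → 0 ℕ.< k → k ℕ.< p → ¬ ConjugationDomain._≈_ ℂ (ConjugationDomain._^_ ℂ ζ k) (ConjugationDomain.1# ℂ))
  (𝔽 : FiniteField p n c ℓ) (F : Func (FiniteField.setoid 𝔽) (FiniteField.setoid 𝔽)) where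

  open AdditiveCharacter ℂ p-prime ζ ζ^p≈1 ζ^k≉1 𝔽 hiding (module ℂ)
  private
    module ℂ = ConjugationDomain ℂ
  open Func F using () renaming (to to f; cong to f-cong)
  open ℂ hiding (zero; _^_)
  open Mult ℂ.semiring using (×-homo-+; ×1-homo-*) renaming (_×_ to _×ℕ_)
  open Sum ℂ.semiring using (∑-comm; ∑-distrib-+; *-distribˡ-sum; *-distribʳ-sum)
  open IntegerImage commutativeRing using () renaming (module Solver to ℂ-Solver)
  open IntegerImage 𝔽.commutativeRing using () renaming (module Solver to 𝔽-Solver)
  open Preimages 𝔽 F using (count; one; two; count≡; one-single; collisions; ∑const; bound; ∑bound; ∑ᶠ-pushforward)
  open Algebra.Properties.Ring 𝔽.ring using () renaming (-0#≈0# to -0≈0)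
  open SetoidReasoning setoid
  private
    module ℕᶠ = FieldSums 𝔽 ℕ.+-0-commutativeMonoid

  q : ℕ
  q = p ℕ.^ n

  q≢0 : ℕ.NonZero q
  q≢0 = ℕ.m^n≢0 p n {{prime⇒nonZero p-prime}}

  ⟦_⟧ : ℕ → Carrier
  ⟦ k ⟧ = k ×ℕ 1#

  ∑ᶠ-⟦⟧ : (g : 𝔽.Carrier → ℕ) → ∑ᶠ (λ x → ⟦ g x ⟧) ≈ ⟦ ℕᶠ.∑ᶠ g ⟧
  ∑ᶠ-⟦⟧ g = NaturalSums.sum-×1 ℂ.semiring {q} (λ i → g (𝔽.element i))

  ∑ᶠ-⟦q*⟧ : (g : 𝔽.Carrier → ℕ) → ∑ᶠ (λ x → ⟦ q ℕ.* g x ⟧) ≈ ⟦ q ℕ.* ℕᶠ.∑ᶠ g ⟧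
  ∑ᶠ-⟦q*⟧ g = trans (∑ᶠ-⟦⟧ (λ x → q ℕ.* g x))
    (reflexive (≡.cong ⟦_⟧ (≡.sym (ℕ-Sum.*-distribˡ-sum {q} q (λ i → g (𝔽.element i))))))

  W V : 𝔽.Carrier → 𝔽.Carrier → Carrier
  W b a = ∑ᶠ (λ x → χ (b 𝔽.* f x 𝔽.- a 𝔽.* x))
  V b a = W b a * conj (W b a)

  V-expand : ∀ b a → V b a ≈ ∑ᶠ (λ x → ∑ᶠ (λ y → χ (b 𝔽.* (f y 𝔽.- f x) 𝔽.+ a 𝔽.* (x 𝔽.- y))))
  V-expand b a = begin
    W b a * conj (W b a)
      ≈⟨ *-congˡ (trans (conj-sum {q} _) (∑ᶠ-cong (λ x → χ-conj (u x)))) ⟩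
    W b a * ∑ᶠ (λ x → χ (𝔽.- u x))
      ≈⟨ *-distribˡ-sum {q} (W b a) (λ i → χ (𝔽.- u (𝔽.element i))) ⟩
    ∑ᶠ (λ x → W b a * χ (𝔽.- u x))
      ≈⟨ ∑ᶠ-cong (λ x → *-distribʳ-sum {q} (χ (𝔽.- u x)) (λ i → χ (u (𝔽.element i)))) ⟩
    ∑ᶠ (λ x → ∑ᶠ (λ y → χ (u y) * χ (𝔽.- u x)))
      ≈⟨ ∑ᶠ-cong (λ x → ∑ᶠ-cong (λ y → trans (sym (χ-+ (u y) (𝔽.- u x))) (χ-cong (rearrange x y)))) ⟩
    ∑ᶠ (λ x → ∑ᶠ (λ y → χ (b 𝔽.* (f y 𝔽.- f x) 𝔽.+ a 𝔽.* (x 𝔽.- y))))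
      ∎
    where
    u : 𝔽.Carrier → 𝔽.Carrier
    u x = b 𝔽.* f x 𝔽.- a 𝔽.* x

    rearrange : ∀ x y → u y 𝔽.- u x 𝔽.≈ b 𝔽.* (f y 𝔽.- f x) 𝔽.+ a 𝔽.* (x 𝔽.- y)
    rearrange x y = solve 6 (λ b a fx fy x y → (b :* fy :- a :* y) :- (b :* fx :- a :* x) :=
      b :* (fy :- fx) :+ a :* (x :- y)) 𝔽.refl b a (f x) (f y) x y
      where open 𝔽-Solver

  derivative : 𝔽.Carrier → 𝔽.Carrier → 𝔽.Carrier
  derivative d x = f (x 𝔽.+ d) 𝔽.- f x

  correlation : 𝔽.Carrier → 𝔽.Carrier → Carrier
  correlation d b = ∑ᶠ (λ x → χ (b 𝔽.* derivative d x))

  -- The Wiener-Khinchin relation: the Fourier transform of |W(b,·)|² is an autocorrelation, because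
  -- summing over `a` forces `y = x + d`. For d = 0 it is Parseval's identity; for nonzero d it
  -- turns constancy of |W(b,·)| into a vanishing correlation.
  ∑V*χ : ∀ b d → ∑ᶠ (λ a → V b a * χ (a 𝔽.* d)) ≈ ⟦ q ⟧ * correlation d b
  ∑V*χ b d = begin
    ∑ᶠ (λ a → V b a * χ (a 𝔽.* d))
      ≈⟨ ∑ᶠ-cong (λ a → trans (*-congʳ (V-expand b a)) (distribute a)) ⟩
    ∑ᶠ (λ a → ∑ᶠ (λ x → ∑ᶠ (λ y → s x y * χ (a 𝔽.* t x y))))
      ≈⟨ ∑-comm {q} {q} _ ⟩
    ∑ᶠ (λ x → ∑ᶠ (λ a → ∑ᶠ (λ y → s x y * χ (a 𝔽.* t x y))))
      ≈⟨ ∑ᶠ-cong (λ x → ∑-comm {q} {q} (λ i j → s x (𝔽.element j) * χ (𝔽.element i 𝔽.* t x (𝔽.element j)))) ⟩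
    ∑ᶠ (λ x → ∑ᶠ (λ y → ∑ᶠ (λ a → s x y * χ (a 𝔽.* t x y))))
      ≈⟨ ∑ᶠ-cong (λ x → ∑ᶠ-cong (λ y → trans (sym (*-distribˡ-sum {q} (s x y) (λ i → χ (𝔽.element i 𝔽.* t x y)))) (*-congˡ (orthogonality (t x y))))) ⟩
    ∑ᶠ (λ x → ∑ᶠ (λ y → s x y * ⟦ q ℕ.* zero? (t x y) ⟧))
      ≈⟨ ∑ᶠ-cong single ⟩
    ∑ᶠ (λ x → ⟦ q ⟧ * s x (x 𝔽.+ d))
      ≈⟨ *-distribˡ-sum {q} ⟦ q ⟧ (λ i → s (𝔽.element i) (𝔽.element i 𝔽.+ d)) ⟨
    ⟦ q ⟧ * correlation d b
      ∎
    where
    s : 𝔽.Carrier → 𝔽.Carrier → Carrier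
    s x y = χ (b 𝔽.* (f y 𝔽.- f x))

    t : 𝔽.Carrier → 𝔽.Carrier → 𝔽.Carrier
    t x y = x 𝔽.- y 𝔽.+ d

    term : ∀ a x y → χ (b 𝔽.* (f y 𝔽.- f x) 𝔽.+ a 𝔽.* (x 𝔽.- y)) * χ (a 𝔽.* d) ≈ s x y * χ (a 𝔽.* t x y)
    term a x y = begin
      χ (v 𝔽.+ a 𝔽.* (x 𝔽.- y)) * χ (a 𝔽.* d)        ≈⟨ *-congʳ (χ-+ v (a 𝔽.* (x 𝔽.- y))) ⟩
      χ v * χ (a 𝔽.* (x 𝔽.- y)) * χ (a 𝔽.* d)        ≈⟨ *-assoc _ _ _ ⟩
      χ v * (χ (a 𝔽.* (x 𝔽.- y)) * χ (a 𝔽.* d))      ≈⟨ *-congˡ (trans (sym (χ-+ (a 𝔽.* (x 𝔽.- y)) (a 𝔽.* d))) (χ-cong (𝔽.sym (𝔽.distribˡ a (x 𝔽.- y) d)))) ⟩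
      χ v * χ (a 𝔽.* t x y)                          ∎
      where v = b 𝔽.* (f y 𝔽.- f x)

    distribute : ∀ a → ∑ᶠ (λ x → ∑ᶠ (λ y → χ (b 𝔽.* (f y 𝔽.- f x) 𝔽.+ a 𝔽.* (x 𝔽.- y)))) * χ (a 𝔽.* d)
      ≈ ∑ᶠ (λ x → ∑ᶠ (λ y → s x y * χ (a 𝔽.* t x y)))
    distribute a = trans (*-distribʳ-sum {q} (χ (a 𝔽.* d)) _)
      (∑ᶠ-cong (λ x → trans (*-distribʳ-sum {q} (χ (a 𝔽.* d)) _) (∑ᶠ-cong (λ y → term a x y))))

    s-cong : ∀ x {y z} → y 𝔽.≈ z → s x y ≈ s x z
    s-cong x y≈z = χ-cong (𝔽.*-congˡ (𝔽.+-congʳ (f-cong y≈z)))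

    t-cong : ∀ x {y z} → y 𝔽.≈ z → t x y 𝔽.≈ t x z
    t-cong x y≈z = 𝔽.+-congʳ (𝔽.+-congˡ (𝔽.-‿cong y≈z))

    t≈0 : ∀ x → t x (x 𝔽.+ d) 𝔽.≈ 𝔽.0#
    t≈0 x = solve 2 (λ x d → x :- (x :+ d) :+ d := con ℤ.0ℤ) 𝔽.refl x d
      where open 𝔽-Solver

    t≉0 : ∀ x y → ¬ y 𝔽.≈ x 𝔽.+ d → ¬ t x y 𝔽.≈ 𝔽.0#
    t≉0 x y y≉ t≈0 = y≉ (𝔽.sym (𝔽.trans
      (solve 3 (λ x d y → x :+ d := x :- y :+ d :+ y) 𝔽.refl x d y)
      (𝔽.trans (𝔽.+-congʳ t≈0) (𝔽.+-identityˡ y))))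
      where open 𝔽-Solver

    single : ∀ x → ∑ᶠ (λ y → s x y * ⟦ q ℕ.* zero? (t x y) ⟧) ≈ ⟦ q ⟧ * s x (x 𝔽.+ d)
    single x = begin
      ∑ᶠ (λ y → s x y * ⟦ q ℕ.* zero? (t x y) ⟧)
        ≈⟨ ∑ᶠ-single (λ y≈z → *-cong (s-cong x y≈z) (reflexive (≡.cong (λ k → ⟦ q ℕ.* k ⟧) (zero?-cong (t-cong x y≈z)))))
            (x 𝔽.+ d) (λ y y≉ → trans (*-congˡ (reflexive (≡.cong ⟦_⟧ (≡.trans (≡.cong (q ℕ.*_) (zero?-≉0 (t≉0 x y y≉))) (ℕ.*-zeroʳ q))))) (zeroʳ _)) ⟩
      s x (x 𝔽.+ d) * ⟦ q ℕ.* zero? (t x (x 𝔽.+ d)) ⟧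
        ≈⟨ *-comm _ _ ⟩
      ⟦ q ℕ.* zero? (t x (x 𝔽.+ d)) ⟧ * s x (x 𝔽.+ d)
        ≡⟨ ≡.cong (λ k → ⟦ k ⟧ * s x (x 𝔽.+ d)) (≡.trans (≡.cong (q ℕ.*_) (zero?-≈0 (t≈0 x))) (ℕ.*-identityʳ q)) ⟩
      ⟦ q ⟧ * s x (x 𝔽.+ d)
        ∎

  correlation-≈1 : ∀ {d b} → (∀ x → b 𝔽.* derivative d x 𝔽.≈ 𝔽.0#) → correlation d b ≈ ⟦ q ⟧
  correlation-≈1 eq = trans (∑ᶠ-cong (λ x → χ-0 (eq x))) ∑ᶠ-1

  parseval : ∀ b → ∑ᶠ (V b) ≈ ⟦ q ℕ.* q ⟧
  parseval b = begin
    ∑ᶠ (V b)                               ≈⟨ ∑ᶠ-cong {λ a → V b a * χ (a 𝔽.* 𝔽.0#)} (λ a → trans (*-congˡ (χ-0 (𝔽.zeroʳ a))) (*-identityʳ _)) ⟨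
    ∑ᶠ (λ a → V b a * χ (a 𝔽.* 𝔽.0#))      ≈⟨ ∑V*χ b 𝔽.0# ⟩
    ⟦ q ⟧ * correlation 𝔽.0# b             ≈⟨ *-congˡ (correlation-≈1 (λ x → 𝔽.trans (𝔽.*-congˡ (derivative-0 x)) (𝔽.zeroʳ b))) ⟩
    ⟦ q ⟧ * ⟦ q ⟧                          ≈⟨ ×1-homo-* q q ⟨
    ⟦ q ℕ.* q ⟧                            ∎
    where
    derivative-0 : ∀ x → derivative 𝔽.0# x 𝔽.≈ 𝔽.0#
    derivative-0 x = 𝔽.trans (𝔽.+-congʳ (f-cong (𝔽.+-identityʳ x))) (𝔽.-‿inverseʳ (f x))

  -- Here the sum runs over `b` instead of `a`, so orthogonality selects the pairs with `f y ≈ f x`.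
  ∑V-0 : ∑ᶠ (λ b → V b 𝔽.0#) ≈ ⟦ q ℕ.* collisions ⟧
  ∑V-0 = begin
    ∑ᶠ (λ b → V b 𝔽.0#)
      ≈⟨ ∑ᶠ-cong (λ b → trans (V-expand b 𝔽.0#) (∑ᶠ-cong (λ x → ∑ᶠ-cong (λ y → χ-cong
          (𝔽.trans (𝔽.+-congˡ (𝔽.zeroˡ (x 𝔽.- y))) (𝔽.+-identityʳ (b 𝔽.* (f y 𝔽.- f x)))))))) ⟩
    ∑ᶠ (λ b → ∑ᶠ (λ x → ∑ᶠ (λ y → χ (b 𝔽.* (f y 𝔽.- f x)))))
      ≈⟨ ∑-comm {q} {q} _ ⟩
    ∑ᶠ (λ x → ∑ᶠ (λ b → ∑ᶠ (λ y → χ (b 𝔽.* (f y 𝔽.- f x)))))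
      ≈⟨ ∑ᶠ-cong (λ x → ∑-comm {q} {q} (λ i j → χ (𝔽.element i 𝔽.* (f (𝔽.element j) 𝔽.- f x)))) ⟩
    ∑ᶠ (λ x → ∑ᶠ (λ y → ∑ᶠ (λ b → χ (b 𝔽.* (f y 𝔽.- f x)))))
      ≈⟨ ∑ᶠ-cong (λ x → trans (∑ᶠ-cong (λ y → orthogonality (f y 𝔽.- f x))) (∑ᶠ-⟦q*⟧ (λ y → zero? (f y 𝔽.- f x)))) ⟩
    ∑ᶠ (λ x → ⟦ q ℕ.* count (f x) ⟧)
      ≈⟨ ∑ᶠ-⟦q*⟧ (λ x → count (f x)) ⟩
    ⟦ q ℕ.* collisions ⟧
      ∎

  conj-⟦⟧ : ∀ k → conj ⟦ k ⟧ ≈ ⟦ k ⟧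
  conj-⟦⟧ zero    = conj-0
  conj-⟦⟧ (suc k) = trans (conj-+ 1# ⟦ k ⟧) (+-cong conj-1 (conj-⟦⟧ k))

  V-0-0 : ∀ {b} → b 𝔽.≈ 𝔽.0# → V b 𝔽.0# ≈ ⟦ q ℕ.* q ⟧
  V-0-0 {b} b≈0 = begin
    V b 𝔽.0#                       ≈⟨ *-cong W≈q (trans (conj-cong W≈q) (conj-⟦⟧ q)) ⟩
    ⟦ q ⟧ * ⟦ q ⟧                  ≈⟨ ×1-homo-* q q ⟨
    ⟦ q ℕ.* q ⟧                    ∎
    where
    W≈q : W b 𝔽.0# ≈ ⟦ q ⟧
    W≈q = trans (∑ᶠ-cong (λ x → χ-0 (𝔽.trans (𝔽.+-cong (𝔽.trans (𝔽.*-congʳ b≈0) (𝔽.zeroˡ (f x)))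
      (𝔽.trans (𝔽.-‿cong (𝔽.zeroˡ x)) -0≈0)) (𝔽.+-identityˡ 𝔽.0#)))) ∑ᶠ-1

  module _ (2∤p : 2 ∤ p) (twoToOne : TwoToOne 𝔽 F) where

    -- W b 0 is χ (b y₀) + 2 s with y₀ the point that has a single preimage.
    V-0-≉0 : ∀ b → ¬ V b 𝔽.0# ≈ 0#
    V-0-≉0 b V≈0 = 1+2z≉0 z∈ (trans (sym V≈1+2z) V≈0)
      where
      i₀ = proj₁ (one-single 2∤p twoToOne)
      y₀ = 𝔽.element i₀
      w  = χ (b 𝔽.* y₀)
      s  = ∑ᶠ (λ y → ⟦ two y ⟧ * χ (b 𝔽.* y))
      -- From (w + 2s)(conj w + 2 conj s) = 1 + 2(w conj s + s conj w + 2 s conj s), using w conj w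
      -- = 1. This is the shape that `1+2z≉0` excludes.
      z  = w * conj s + s * conj w + (s * conj s + s * conj s)

      ⟦two⟧* : ∀ y {t} → ℤ[ζ] t → ℤ[ζ] (⟦ two y ⟧ * t)
      ⟦two⟧* y = ℤ[ζ]-scale (ℤ.+ two y)

      χ∈ : ∀ x → ℤ[ζ] (χ x)
      χ∈ x = ℤ[ζ]-^ (exponent x)

      conj-χ∈ : ∀ x → ℤ[ζ] (conj (χ x))
      conj-χ∈ x = ℤ[ζ]-resp (sym (χ-conj x)) (χ∈ (𝔽.- x))

      s∈ : ℤ[ζ] s
      s∈ = ℤ[ζ]-sum {q} _ (λ i → ⟦two⟧* (𝔽.element i) (χ∈ _))

      conj-s∈ : ℤ[ζ] (conj s)
      conj-s∈ = ℤ[ζ]-resp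
        (sym (trans (conj-sum {q} _) (∑ᶠ-cong (λ y → trans (conj-* ⟦ two y ⟧ (χ (b 𝔽.* y))) (*-congʳ (conj-⟦⟧ (two y)))))))
        (ℤ[ζ]-sum {q} _ (λ i → ⟦two⟧* (𝔽.element i) (conj-χ∈ _)))

      z∈ : ℤ[ζ] z
      z∈ = ℤ[ζ]-+ (ℤ[ζ]-+ (ℤ[ζ]-* (χ∈ _) conj-s∈) (ℤ[ζ]-* s∈ (conj-χ∈ _))) (ℤ[ζ]-+ ss∈ ss∈)
        where ss∈ = ℤ[ζ]-* s∈ conj-s∈

      split : ∀ k l t → ⟦ k ℕ.+ 2 ℕ.* l ⟧ * t ≈ ⟦ k ⟧ * t + (⟦ l ⟧ * t + ⟦ l ⟧ * t)
      split k l t = begin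
        ⟦ k ℕ.+ 2 ℕ.* l ⟧ * t
          ≈⟨ *-congʳ (trans (×-homo-+ 1# k (2 ℕ.* l)) (+-congˡ (trans (×-homo-+ 1# l (l ℕ.+ 0)) (+-congˡ (reflexive (≡.cong ⟦_⟧ (ℕ.+-identityʳ l))))))) ⟩
        (⟦ k ⟧ + (⟦ l ⟧ + ⟦ l ⟧)) * t
          ≈⟨ trans (distribʳ t ⟦ k ⟧ _) (+-congˡ (distribʳ t ⟦ l ⟧ ⟦ l ⟧)) ⟩
        ⟦ k ⟧ * t + (⟦ l ⟧ * t + ⟦ l ⟧ * t)
          ∎

      W≈w+2s : W b 𝔽.0# ≈ w + (s + s)
      W≈w+2s = begin
        W b 𝔽.0#
          ≈⟨ ∑ᶠ-cong (λ x → χ-cong (𝔽.trans (𝔽.+-congˡ (𝔽.trans (𝔽.-‿cong (𝔽.zeroˡ x)) -0≈0)) (𝔽.+-identityʳ (b 𝔽.* f x)))) ⟩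
        ∑ᶠ (λ x → χ (b 𝔽.* f x))
          ≈⟨ ∑ᶠ-pushforward ℂ.semiring (λ y → χ (b 𝔽.* y)) (λ y≈z → χ-cong (𝔽.*-congˡ y≈z)) ⟩
        ∑ᶠ (λ y → ⟦ count y ⟧ * χ (b 𝔽.* y))
          ≈⟨ ℂ-Sum.sum-cong-≋ {q} (λ i → let y = 𝔽.element i in
              trans (*-congʳ (reflexive (≡.cong ⟦_⟧ (≡.sym (count≡ 2∤p twoToOne i))))) (split (one y) (two y) (χ (b 𝔽.* y)))) ⟩
        ∑ᶠ (λ y → ⟦ one y ⟧ * χ (b 𝔽.* y) + (⟦ two y ⟧ * χ (b 𝔽.* y) + ⟦ two y ⟧ * χ (b 𝔽.* y)))
          ≈⟨ trans (∑-distrib-+ {q} _ _) (+-congˡ (∑-distrib-+ {q} _ _)) ⟩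
        ∑ᶠ (λ y → ⟦ one y ⟧ * χ (b 𝔽.* y)) + (s + s)
          ≈⟨ +-congʳ (SingleTerm.sum-single ℂ.+-commutativeMonoid _ i₀ (λ j j≢i₀ →
              trans (*-congʳ (reflexive (≡.cong ⟦_⟧ (proj₂ (proj₂ (one-single 2∤p twoToOne)) j j≢i₀)))) (zeroˡ _))) ⟩
        ⟦ one y₀ ⟧ * w + (s + s)
          ≈⟨ +-congʳ (trans (*-congʳ (trans (reflexive (≡.cong ⟦_⟧ (proj₁ (proj₂ (one-single 2∤p twoToOne))))) (+-identityʳ 1#))) (*-identityˡ w)) ⟩
        w + (s + s)
          ∎
        where module ℂ-Sum = Sum ℂ.semiring

      w*conj-w≈1 : w * conj w ≈ 1#
      w*conj-w≈1 = trans (*-congˡ (χ-conj (b 𝔽.* y₀))) (trans (sym (χ-+ (b 𝔽.* y₀) _)) (χ-0 (𝔽.-‿inverseʳ (b 𝔽.* y₀))))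

      V≈1+2z : V b 𝔽.0# ≈ 1# + (z + z)
      V≈1+2z = begin
        W b 𝔽.0# * conj (W b 𝔽.0#)
          ≈⟨ *-cong W≈w+2s (trans (conj-cong W≈w+2s) (trans (conj-+ w (s + s)) (+-congˡ (conj-+ s s)))) ⟩
        (w + (s + s)) * (conj w + (conj s + conj s))
          ≈⟨ solve 4 (λ w w′ s s′ → (w :+ (s :+ s)) :* (w′ :+ (s′ :+ s′)) :=
               w :* w′ :+ ((w :* s′ :+ s :* w′ :+ (s :* s′ :+ s :* s′)) :+ (w :* s′ :+ s :* w′ :+ (s :* s′ :+ s :* s′)))) refl w (conj w) s (conj s) ⟩
        w * conj w + (z + z)
          ≈⟨ +-congʳ w*conj-w≈1 ⟩
        1# + (z + z)
          ∎
        where open ℂ-Solver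

    -- Here `k` is the squared amplitude p^(n+s), and `q ≤ k` because s ≥ 0.
    module _ (plateau : ∀ b → ¬ b 𝔽.≈ 𝔽.0# → ∃[ k ] q ℕ.≤ k × (∀ a → V b a ≈ 0# ⊎ V b a ≈ ⟦ k ⟧)) where

      -- Provides natural numbers to be compared with `bound`. The element b = 0 is included because
      -- the total known from `∑V-0` runs over the whole field.
      V-0-value : ∀ b → ∃[ k ] bound b ℕ.≤ k × V b 𝔽.0# ≈ ⟦ k ⟧
      V-0-value b with b 𝔽.≟ 𝔽.0#
      ... | yes b≈0 = q ℕ.* q , ℕ.≤-reflexive (≡.trans
        (≡.cong (λ k → q ℕ.+ k ℕ.* (q ℕ.* q ℕ.∸ q)) (zero?-≈0 b≈0))
        (≡.trans (≡.cong (q ℕ.+_) (ℕ.+-identityʳ _)) (ℕ.m+[n∸m]≡n (ℕ.m≤m*n q q {{q≢0}})))) , V-0-0 b≈0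
      ... | no b≉0 with plateau b b≉0
      ...   | k , q≤k , V≈ with V≈ 𝔽.0#
      ...     | inj₁ V≈0 = contradiction V≈0 (V-0-≉0 b)
      ...     | inj₂ V≈k = k , ℕ.≤-trans (ℕ.≤-reflexive (≡.trans
        (≡.cong (λ k → q ℕ.+ k ℕ.* (q ℕ.* q ℕ.∸ q)) (zero?-≉0 b≉0)) (ℕ.+-identityʳ q))) q≤k , V≈k

      -- The natural values dominate `bound` termwise and have the same total `q * collisions`, so
      -- they coincide with it. Indices replace field elements since `sum-≤-≡` compares the terms of
      -- the enumeration.
      V-0≈q : ∀ i → ¬ 𝔽.element i 𝔽.≈ 𝔽.0# → V (𝔽.element i) 𝔽.0# ≈ ⟦ q ⟧
      V-0≈q i b≉0 = trans (proj₂ (proj₂ (V-0-value b))) (reflexive (≡.cong ⟦_⟧ (≡.trans (≡.sym (bound≡ i))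
        (≡.trans (≡.cong (λ k → q ℕ.+ k ℕ.* (q ℕ.* q ℕ.∸ q)) (zero?-≉0 b≉0)) (ℕ.+-identityʳ q)))))
        where
        b = 𝔽.element i
        value : 𝔽.Carrier → ℕ
        value b = proj₁ (V-0-value b)

        bound≡ : ∀ i → bound (𝔽.element i) ≡ value (𝔽.element i)
        bound≡ = sum-≤-≡ _ _ (λ i → proj₁ (proj₂ (V-0-value (𝔽.element i))))
          (≡.trans (∑bound 2∤p twoToOne) (×1-injective (sym (begin
            ⟦ ℕᶠ.∑ᶠ value ⟧              ≈⟨ ∑ᶠ-⟦⟧ value ⟨
            ∑ᶠ (λ b → ⟦ value b ⟧)       ≈⟨ ∑ᶠ-cong (λ b → proj₂ (proj₂ (V-0-value b))) ⟨
            ∑ᶠ (λ b → V b 𝔽.0#)          ≈⟨ ∑V-0 ⟩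
            ⟦ q ℕ.* collisions ⟧         ∎))))

      -- The value at a = 0 is nonzero, so it is the amplitude `k`, and by `V-0≈q` this is q. Hence
      -- all values are at most q, while Parseval makes their total q · q over q elements.
      V≈q : ∀ i j → ¬ 𝔽.element i 𝔽.≈ 𝔽.0# → V (𝔽.element i) (𝔽.element j) ≈ ⟦ q ⟧
      V≈q i j b≉0 = trans (proj₂ (proj₂ (V-value (𝔽.element j)))) (reflexive (≡.cong ⟦_⟧ (value≡ j)))
        where
        b = 𝔽.element i

        V-value : ∀ a → ∃[ k ] k ℕ.≤ q × V b a ≈ ⟦ k ⟧
        V-value a with plateau b b≉0
        ... | k , q≤k , V≈ with V≈ 𝔽.0# | V≈ a
        ...   | inj₁ V≈0 | _         = contradiction V≈0 (V-0-≉0 b)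
        ...   | inj₂ _   | inj₁ V≈0  = 0 , ℕ.z≤n , V≈0
        ...   | inj₂ V≈k | inj₂ Va≈k = k , ℕ.≤-reflexive (×1-injective (trans (sym V≈k) (V-0≈q i b≉0))) , Va≈k

        value : 𝔽.Carrier → ℕ
        value a = proj₁ (V-value a)

        value≡ : ∀ j → value (𝔽.element j) ≡ q
        value≡ = sum-≤-≡ _ _ (λ j → proj₁ (proj₂ (V-value (𝔽.element j))))
          (≡.trans (×1-injective (begin
            ⟦ ℕᶠ.∑ᶠ value ⟧              ≈⟨ ∑ᶠ-⟦⟧ value ⟨
            ∑ᶠ (λ a → ⟦ value a ⟧)       ≈⟨ ∑ᶠ-cong (λ a → proj₂ (proj₂ (V-value a))) ⟨
            ∑ᶠ (V b)                     ≈⟨ parseval b ⟩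
            ⟦ q ℕ.* q ⟧                  ∎)) (≡.sym (∑const q)))

      -- For nonzero b the constant value of `V b` comes out of the sum in `∑V*χ`, leaving a full
      -- character sum at d, which is zero as d is nonzero. At b = 0 every term is 1.
      correlation≈ : ∀ {d} → ¬ d 𝔽.≈ 𝔽.0# → ∀ i → correlation d (𝔽.element i) ≈ ⟦ q ℕ.* zero? (𝔽.element i) ⟧
      correlation≈ {d} d≉0 i with 𝔽.element i 𝔽.≟ 𝔽.0#
      ... | yes b≈0 = trans (correlation-≈1 (λ x → 𝔽.trans (𝔽.*-congʳ b≈0) (𝔽.zeroˡ (derivative d x))))
        (reflexive (≡.cong ⟦_⟧ (≡.sym (≡.trans (≡.cong (q ℕ.*_) (zero?-≈0 b≈0)) (ℕ.*-identityʳ q)))))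
      ... | no b≉0  = trans (⟦q⟧-cancel (begin
          ⟦ q ⟧ * correlation d b                         ≈⟨ ∑V*χ b d ⟨
          ∑ᶠ (λ a → V b a * χ (a 𝔽.* d))                  ≈⟨ Sum.sum-cong-≋ ℂ.semiring {q} (λ j → *-congʳ (V≈q i j b≉0)) ⟩
          ∑ᶠ (λ a → ⟦ q ⟧ * χ (a 𝔽.* d))                  ≈⟨ *-distribˡ-sum {q} ⟦ q ⟧ (λ j → χ (𝔽.element j 𝔽.* d)) ⟨
          ⟦ q ⟧ * ∑ᶠ (λ a → χ (a 𝔽.* d))                  ≈⟨ *-congˡ (trans (orthogonality d) (reflexive (≡.cong ⟦_⟧ (q*zero? d≉0)))) ⟩
          ⟦ q ⟧ * 0#                                      ≈⟨ zeroʳ _ ⟩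
          0#                                              ∎))
          (reflexive (≡.cong ⟦_⟧ (≡.sym (q*zero? b≉0))))
        where
        b = 𝔽.element i

        q*zero? : ∀ {x} → ¬ x 𝔽.≈ 𝔽.0# → q ℕ.* zero? x ≡ 0
        q*zero? x≉0 = ≡.trans (≡.cong (q ℕ.*_) (zero?-≉0 x≉0)) (ℕ.*-zeroʳ q)

        ⟦q⟧-cancel : ∀ {z} → ⟦ q ⟧ * z ≈ 0# → z ≈ 0#
        ⟦q⟧-cancel {z} eq = torsionFree (ℕ.pred q)
          (trans (reflexive (≡.cong (λ k → ⟦ k ⟧ * z) (ℕ.suc-pred q {{q≢0}}))) eq)

      -- Orthogonality writes q times the number of solutions as the sum over b of
      -- `correlation d b * χ (b * - e)`. Only b = 0 survives and contributes q.
      solutions≡1 : ∀ {d} → ¬ d 𝔽.≈ 𝔽.0# → ∀ e → ℕᶠ.∑ᶠ (λ x → zero? (derivative d x 𝔽.- e)) ≡ 1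
      solutions≡1 {d} d≉0 e = ℕ.*-cancelˡ-≡ _ 1 q {{q≢0}} (≡.trans (×1-injective (begin
        ⟦ q ℕ.* ℕᶠ.∑ᶠ (λ x → zero? (derivative d x 𝔽.- e)) ⟧
          ≈⟨ ∑ᶠ-⟦q*⟧ (λ x → zero? (derivative d x 𝔽.- e)) ⟨
        ∑ᶠ (λ x → ⟦ q ℕ.* zero? (derivative d x 𝔽.- e) ⟧)
          ≈⟨ ∑ᶠ-cong (λ x → orthogonality (derivative d x 𝔽.- e)) ⟨
        ∑ᶠ (λ x → ∑ᶠ (λ b → χ (b 𝔽.* (derivative d x 𝔽.- e))))
          ≈⟨ ∑-comm {q} {q} _ ⟩
        ∑ᶠ (λ b → ∑ᶠ (λ x → χ (b 𝔽.* (derivative d x 𝔽.- e))))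
          ≈⟨ ∑ᶠ-cong (λ b → trans
              (∑ᶠ-cong (λ x → trans (χ-cong (𝔽.distribˡ b (derivative d x) (𝔽.- e))) (χ-+ (b 𝔽.* derivative d x) (b 𝔽.* 𝔽.- e))))
              (sym (*-distribʳ-sum {q} (χ (b 𝔽.* 𝔽.- e)) (λ i → χ (b 𝔽.* derivative d (𝔽.element i)))))) ⟩
        ∑ᶠ (λ b → correlation d b * χ (b 𝔽.* 𝔽.- e))
          ≈⟨ Sum.sum-cong-≋ ℂ.semiring {q} (λ i → *-congʳ (correlation≈ d≉0 i)) ⟩
        ∑ᶠ (λ b → ⟦ q ℕ.* zero? b ⟧ * χ (b 𝔽.* 𝔽.- e))
          ≈⟨ ∑ᶠ-single (λ x≈y → *-cong (reflexive (≡.cong (λ k → ⟦ q ℕ.* k ⟧) (zero?-cong x≈y))) (χ-cong (𝔽.*-congʳ x≈y))) 𝔽.0#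
              (λ b b≉0 → trans (*-congʳ (reflexive (≡.cong ⟦_⟧ (≡.trans (≡.cong (q ℕ.*_) (zero?-≉0 b≉0)) (ℕ.*-zeroʳ q))))) (zeroˡ _)) ⟩
        ⟦ q ℕ.* zero? 𝔽.0# ⟧ * χ (𝔽.0# 𝔽.* 𝔽.- e)
          ≈⟨ trans (*-cong (reflexive (≡.cong (λ k → ⟦ q ℕ.* k ⟧) (zero?-≈0 𝔽.refl))) (χ-0 (𝔽.zeroˡ (𝔽.- e)))) (*-identityʳ _) ⟩
        ⟦ q ℕ.* 1 ⟧ ∎)) ≡.refl)

      planar : Planar 𝔽 F
      planar d d≉0 e with sum≡1⇒single _ (solutions≡1 d≉0 e)
      ... | i , solves , unique = 𝔽.element i , x∙y⁻¹≈ε⇒x≈y _ _ (zero?≡1⇒≈0 solves) , same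
        where
        open Algebra.Properties.Ring 𝔽.ring using (x∙y⁻¹≈ε⇒x≈y)
        open Inverse 𝔽.enumeration using (from; strictlyInverseˡ)

        same : ∀ {y} → derivative d y 𝔽.≈ e → 𝔽.element i 𝔽.≈ y
        -- The indicator vanishes at every index other than `i`, whereas it is 1 at the index of a
        -- solution.
        same {y} Dy≈e with from y Fin.≟ i
        ... | yes j≡i = 𝔽.trans (𝔽.reflexive (≡.cong 𝔽.element (≡.sym j≡i))) (strictlyInverseˡ y)
        ... | no j≢i  = contradiction (≡.trans (≡.sym (zero?-≈0 D≈0)) (unique (from y) j≢i)) λ ()
          where
          y′ = 𝔽.element (from y)
          D≈0 : derivative d y′ 𝔽.- e 𝔽.≈ 𝔽.0#
          D≈0 = 𝔽.trans (𝔽.+-congʳ (𝔽.trans (𝔽.+-cong (f-cong (𝔽.+-congʳ (strictlyInverseˡ y))) (𝔽.-‿cong (f-cong (strictlyInverseˡ y)))) Dy≈e))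
            (𝔽.-‿inverseʳ e)

-- Transfer to absolute values and to the Walsh transform of the statement.

theorem6p4 : ∀ {c ℓ r ℓ₁ ℓ₂ : Level} (ℝ : RealNumbers r ℓ₁ ℓ₂) →
    (p n : ℕ) → Prime p → 2 ∤ p →
    (ζ : Complex.ℂ ℝ) → Complex.IsPrimitiveRoot ℝ p ζ →
    (𝔽 : FiniteField p n c ℓ) →
    (F : Func (FiniteField.setoid 𝔽) (FiniteField.setoid 𝔽)) →
    Plateaued 𝔽 ℝ ζ F →
    TwoToOne 𝔽 F →
    Planar 𝔽 F
theorem6p4 ℝ p n p-prime 2∤p ζ (ζ^p≈1 , ζ^k≉1) 𝔽 F plateaued twoToOne =
  planar 2∤p twoToOne λ b b≉0 →
    let s , _ , ∣W∣ = plateaued b b≉0 in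
    p ℕ.^ (n ℕ.+ s) , ℕ.^-monoʳ-≤ p {{prime⇒nonZero p-prime}} (ℕ.m≤m+n n s) , λ a →
    Sum⊎.map (λ eq → trans (V≈ b a) (∣∣≈0⇒*-conj≈0 (Walsh 𝔽 ℝ ζ F b a) eq))
             (λ eq → trans (V≈ b a) (∣∣≈√⇒*-conj≈ (Walsh 𝔽 ℝ ζ F b a) (p ℕ.^ (n ℕ.+ s)) eq)) (∣W∣ a)
  where
  open ComplexFacts ℝ
  open CommutativeRing commutativeRing using (_≈_; _*_)
  open WalshTransform conjugationDomain p-prime ζ ζ^p≈1 ζ^k≉1 𝔽 F
  open AdditiveCharacter conjugationDomain p-prime ζ ζ^p≈1 ζ^k≉1 𝔽 using (module 𝔽; ζ^residue≈χ; Tr-∸)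
  open Func F using () renaming (to to f)

  -- Additivity of the trace: `Walsh` subtracts two traces, while `W` evaluates the character at a
  -- difference.
  Walsh≈W : ∀ b a → Walsh 𝔽 ℝ ζ F b a ≈ W b a
  Walsh≈W b a = Sum.sum-cong-≋ semiring {p ℕ.^ n} λ i → let x = 𝔽.element i in
    ζ^residue≈χ (b 𝔽.* f x 𝔽.- a 𝔽.* x) (Tr-∸ (b 𝔽.* f x) (a 𝔽.* x))

  V≈ : ∀ b a → V b a ≈ Walsh 𝔽 ℝ ζ F b a * conj (Walsh 𝔽 ℝ ζ F b a)
  V≈ b a = sym (*-cong (Walsh≈W b a) (conj-cong (Walsh≈W b a)))
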